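{- Let $\mathcal{R}$ be a commutative ring with unit, let $\mathcal{C}$ be a finite abstract simplicial complex, let $\mathcal{V}=\{V_0,\ldots,V_n\}$ be a partition of $V(\mathcal{C})$, and let $m\ge0$ be an integer. If $\widetilde H_{|I|+m-2}(\mathcal{C}[V_I];\mathcal{R})=0$ for all nonempty $I\subseteq\{0,1,\ldots,n\}$, where $V_I=\bigcup_{i\in I}V_i$, then $\widetilde H_{m-1}(\mathbf{Col}(\mathcal{C},\mathcal{V});\mathcal{R})=0$.
   Context: $\mathcal{C}[X]=\{\sigma\in\mathcal{C}:\sigma\subseteq X\}$. $\widetilde H_j$ denotes reduced simplicial homology (with $\widetilde H_{ -1}(\mathcal{K})=0$ iff $\mathcal{K}$ has at least one vertex). The colorful complex $\mathbf{Col}(\mathcal{C},\mathcal{V})$ is the simplicial complex whose vertices are the simplices $\sigma\in\mathcal{C}$ containing at least one vertex of every class $V_i$, and whose simplices are the sets $\{\sigma_1,\ldots,\sigma_\ell\}$ of such simplices with $\sigma_1\subset\cdots\subset\sigma_\ell$. -}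

module Defs where

open import Algebra.Bundles using (CommutativeRing)
open import Algebra.Module.Bundles using (Module)
open import Algebra.Module.Structures.Biased using (IsModuleFromLeft)
import Algebra.Properties.CommutativeSemigroup as CommutativeSemigroupProperties
import Algebra.Properties.Ring as RingProperties
import Algebra.Properties.Semiring.Exp as Exp
import Algebra.Properties.Semiring.Sum as Sum
open import Data.Bool.Base using (if_then_else_)
open import Data.Fin.Base using (Fin; zero; suc; finToFun)
open import Data.Fin.Properties using (all?; 2↔Bool)
open import Data.Fin.Subset using (Subset; inside; outside; ⊥; ⁅_⁆; _∈_; _⊆_; _∩_; _∪_; ⋃; ∣_∣; Nonempty)
open import Data.Fin.Subset.Properties using (_∈?_; _⊆?_; nonempty?; ∉⊥; ⊥⊆)
open import Data.Integer.Base as ℤ using (ℤ; _⊖_)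
open import Data.List.Base using (map; filter; allFin)
open import Data.Nat.Base as ℕ using (ℕ; suc)
open import Data.Product.Base using (∃-syntax; _×_; _,_)
open import Data.Sum.Base using (_⊎_)
open import Data.Vec.Base using (_∷_; tabulate)
open import Function.Bundles using (Inverse)
open import Level using (Level; _⊔_)
open import Relation.Binary.PropositionalEquality.Core using (_≡_)
open import Relation.Nullary.Decidable using (does; _×-dec_; _⊎-dec_; _→-dec_)
open import Relation.Nullary.Negation using (¬_; contradiction)
open import Relation.Unary using (Decidable)

private
  variable
    c ℓ m ℓm : Level
    N : ℕ

-- A finite abstract simplicial complex with vertices among Fin N.  The empty
-- set always counts as a face; an element of Fin N need not be a vertex.

record Complex (N : ℕ) : Set₁ where
  field
    Face   : Subset N → Set
    face?  : Decidable Face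
    face-⊥ : Face ⊥
    face-⊆ : ∀ {σ τ} → σ ⊆ τ → Face τ → Face σ

open Complex public

Vertex : Complex N → Fin N → Set
Vertex K v = Face K ⁅ v ⁆

infix 8 _[_]

_[_] : Complex N → Subset N → Complex N
K [ X ] = record
  { Face   = λ σ → Face K σ × σ ⊆ X
  ; face?  = λ σ → face? K σ ×-dec (σ ⊆? X)
  ; face-⊥ = face-⊥ K , λ {x} → ⊥⊆ {x = x}
  ; face-⊆ = λ σ⊆τ (τ∈K , τ⊆X) → face-⊆ K σ⊆τ τ∈K , λ x∈σ → τ⊆X (σ⊆τ x∈σ)
  }

dim : Subset N → ℤ
dim σ = ∣ σ ∣ ⊖ 1

Simplex : Complex N → ℤ → Subset N → Set
Simplex K j σ = Face K σ × dim σ ≡ j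

-- The number of elements of τ strictly below v.

rank : Fin N → Subset N → ℕ
rank zero    _             = 0
rank (suc v) (inside  ∷ τ) = suc (rank v τ)
rank (suc v) (outside ∷ τ) = rank v τ

module Homology (R : CommutativeRing c ℓ) where

  open CommutativeRing R
  open RingProperties ring using (-0#≈0#; -1*x≈-x; -‿+-comm; x[y-z]≈xy-xz; x≈y⇒x∙y⁻¹≈ε; ⁻¹-anti-homo‿-)
  open Exp semiring using (_^_)
  open Sum semiring using (∑-distrib-+; *-distribˡ-sum; sum-cong-≋; sum-syntax)
  open CommutativeSemigroupProperties +-commutativeSemigroup using (interchange)
  open CommutativeSemigroupProperties *-commutativeSemigroup using (x∙yz≈y∙xz)
  open import Relation.Binary.Reasoning.Setoid setoid

  incidence : Fin N → Subset N → Carrier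
  incidence v τ = if does (v ∈? τ) then 0# else (- 1#) ^ rank v τ

  -- The linear extension of ∂ {v₀ < ⋯ < vⱼ} = ∑ᵢ (-1)ⁱ {v₀ , … , v̂ᵢ , … , vⱼ},
  -- written coefficientwise: τ is a facet of σ exactly when σ = τ ∪ {v} for some
  -- v ∉ τ, and the index i of v in σ is then the number of elements of τ below v.
  -- The case σ = {v}, τ = ∅ is the augmentation.

  ∂ : (Subset N → Carrier) → (Subset N → Carrier)
  ∂ {N} x τ = ∑[ v < N ] (incidence v τ * x (τ ∪ ⁅ v ⁆))

  -- The free module on the j-simplices of K, as the functions on all subsets of
  -- Fin N which vanish off the j-simplices.  For j = -1 the only simplex is ∅.

  record Chain (K : Complex N) (j : ℤ) : Set (c ⊔ ℓ) where
    field
      coeff   : Subset N → Carrier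
      support : ∀ σ → ¬ Simplex K j σ → coeff σ ≈ 0#

  open Chain public

  record Cycle (K : Complex N) (j : ℤ) : Set (c ⊔ ℓ) where
    field
      chain  : Chain K j
      closed : ∀ τ → ∂ (coeff chain) τ ≈ 0#

  open Cycle public

  record Homologous (K : Complex N) (j : ℤ) (y z : Cycle K j) : Set (c ⊔ ℓ) where
    constructor _,_
    field
      filling  : Chain K (ℤ.suc j)
      boundary : ∀ τ → ∂ (coeff filling) τ ≈ coeff (chain y) τ - coeff (chain z) τ

  ∂-cong : {x y : Subset N → Carrier} → (∀ σ → x σ ≈ y σ) → ∀ τ → ∂ x τ ≈ ∂ y τ
  ∂-cong x≈y τ = sum-cong-≋ λ v → *-congˡ (x≈y (τ ∪ ⁅ v ⁆))

  ∂-+ : (x y : Subset N → Carrier) → ∀ τ → ∂ (λ σ → x σ + y σ) τ ≈ ∂ x τ + ∂ y τ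
  ∂-+ x y τ = trans
    (sum-cong-≋ λ v → distribˡ (incidence v τ) (x (τ ∪ ⁅ v ⁆)) (y (τ ∪ ⁅ v ⁆)))
    (∑-distrib-+ (λ v → incidence v τ * x (τ ∪ ⁅ v ⁆)) (λ v → incidence v τ * y (τ ∪ ⁅ v ⁆)))

  ∂-* : (r : Carrier) (x : Subset N → Carrier) → ∀ τ → ∂ (λ σ → r * x σ) τ ≈ r * ∂ x τ
  ∂-* r x τ = trans
    (sum-cong-≋ λ v → x∙yz≈y∙xz (incidence v τ) r (x (τ ∪ ⁅ v ⁆)))
    (sym (*-distribˡ-sum r λ v → incidence v τ * x (τ ∪ ⁅ v ⁆)))

  ∂-0 : ∀ (τ : Subset N) → ∂ (λ _ → 0#) τ ≈ 0#
  ∂-0 τ = begin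
    ∂ (λ _ → 0#) τ       ≈⟨ ∂-cong (λ _ → sym (zeroˡ 0#)) τ ⟩
    ∂ (λ _ → 0# * 0#) τ  ≈⟨ ∂-* 0# (λ _ → 0#) τ ⟩
    0# * ∂ (λ _ → 0#) τ  ≈⟨ zeroˡ _ ⟩
    0#                   ∎

  ∂-neg : (x : Subset N → Carrier) → ∀ τ → ∂ (λ σ → - x σ) τ ≈ - ∂ x τ
  ∂-neg x τ = begin
    ∂ (λ σ → - x σ) τ       ≈⟨ ∂-cong (λ σ → sym (-1*x≈-x (x σ))) τ ⟩
    ∂ (λ σ → - 1# * x σ) τ  ≈⟨ ∂-* (- 1#) x τ ⟩
    - 1# * ∂ x τ            ≈⟨ -1*x≈-x _ ⟩
    - ∂ x τ                 ∎

  module _ {K : Complex N} {j : ℤ} where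

    0ᶜ : Chain K j
    0ᶜ = record { coeff = λ _ → 0# ; support = λ _ _ → refl }

    infixl 6 _+ᶜ_
    infixr 7 _*ᶜ_
    infixr 8 -ᶜ_

    _+ᶜ_ : Chain K j → Chain K j → Chain K j
    x +ᶜ y = record
      { coeff   = λ σ → coeff x σ + coeff y σ
      ; support = λ σ σ∉ → trans (+-cong (support x σ σ∉) (support y σ σ∉)) (+-identityˡ 0#)
      }

    -ᶜ_ : Chain K j → Chain K j
    -ᶜ x = record
      { coeff   = λ σ → - coeff x σ
      ; support = λ σ σ∉ → trans (-‿cong (support x σ σ∉)) -0#≈0#
      }

    _*ᶜ_ : Carrier → Chain K j → Chain K j
    r *ᶜ x = record
      { coeff   = λ σ → r * coeff x σ
      ; support = λ σ σ∉ → trans (*-congˡ (support x σ σ∉)) (zeroʳ r)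
      }

  -- The reduced homology module H̃ⱼ(K; R): cycles, with two cycles equal when
  -- they differ by a boundary.

  H̃ : ℤ → Complex N → Module R (c ⊔ ℓ) (c ⊔ ℓ)
  H̃ {N} j K = record
    { Carrierᴹ = Cycle K j
    ; _≈ᴹ_     = _~_
    ; _+ᴹ_     = _⊕_
    ; _*ₗ_     = _⊛_
    ; _*ᵣ_     = λ z r → r ⊛ z
    ; 0ᴹ       = 𝟘
    ; -ᴹ_      = ⊝_
    ; isModule = IsModuleFromLeft.isModule {commutativeRing = R} (record { isLeftModule = record
      { isLeftSemimodule = record
        { +ᴹ-isCommutativeMonoid = record
          { isMonoid = record
            { isSemigroup = record
              { isMagma = record
                { isEquivalence = record
                  { refl  = pointwise λ _ → refl
                  ; sym   = ~-sym
                  ; trans = ~-trans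
                  }
                ; ∙-cong = ⊕-cong
                }
              ; assoc = λ _ _ _ → pointwise λ _ → +-assoc _ _ _
              }
            ; identity = (λ _ → pointwise λ _ → +-identityˡ _) , (λ _ → pointwise λ _ → +-identityʳ _)
            }
          ; comm = λ _ _ → pointwise λ _ → +-comm _ _
          }
        ; isPreleftSemimodule = record
          { *ₗ-cong      = ⊛-cong
          ; *ₗ-zeroˡ     = λ _ → pointwise λ _ → zeroˡ _
          ; *ₗ-distribʳ  = λ _ _ _ → pointwise λ _ → distribʳ _ _ _
          ; *ₗ-identityˡ = λ _ → pointwise λ _ → *-identityˡ _
          ; *ₗ-assoc     = λ _ _ _ → pointwise λ _ → *-assoc _ _ _
          ; *ₗ-zeroʳ     = λ _ → pointwise λ _ → zeroʳ _
          ; *ₗ-distribˡ  = λ _ _ _ → pointwise λ _ → distribˡ _ _ _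
          }
        }
      ; -ᴹ‿cong    = ⊝-cong
      ; -ᴹ‿inverse = (λ _ → pointwise λ _ → -‿inverseˡ _) , (λ _ → pointwise λ _ → -‿inverseʳ _)
      } })
    }
    where
    infix  4 _~_
    infixl 6 _⊕_
    infixr 7 _⊛_
    infixr 8 ⊝_

    _~_ : Cycle K j → Cycle K j → Set (c ⊔ ℓ)
    _~_ = Homologous K j

    _⟨_⟩ : Cycle K j → Subset N → Carrier
    z ⟨ σ ⟩ = coeff (chain z) σ

    𝟘 : Cycle K j
    𝟘 = record { chain = 0ᶜ ; closed = ∂-0 }

    _⊕_ : Cycle K j → Cycle K j → Cycle K j
    y ⊕ z = record
      { chain  = chain y +ᶜ chain z
      ; closed = λ τ → trans (∂-+ (y ⟨_⟩) (z ⟨_⟩) τ) (trans (+-cong (closed y τ) (closed z τ)) (+-identityˡ 0#))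
      }

    ⊝_ : Cycle K j → Cycle K j
    ⊝ z = record
      { chain  = -ᶜ chain z
      ; closed = λ τ → trans (∂-neg (z ⟨_⟩) τ) (trans (-‿cong (closed z τ)) -0#≈0#)
      }

    _⊛_ : Carrier → Cycle K j → Cycle K j
    r ⊛ z = record
      { chain  = r *ᶜ chain z
      ; closed = λ τ → trans (∂-* r (z ⟨_⟩) τ) (trans (*-congˡ (closed z τ)) (zeroʳ r))
      }

    pointwise : ∀ {y z} → (∀ σ → y ⟨ σ ⟩ ≈ z ⟨ σ ⟩) → y ~ z
    pointwise y≈z = 0ᶜ , λ τ → trans (∂-0 τ) (sym (x≈y⇒x∙y⁻¹≈ε (y≈z τ)))

    ~-sym : ∀ {y z} → y ~ z → z ~ y
    ~-sym (d , ∂d) = -ᶜ d , λ τ → trans (∂-neg (coeff d) τ) (trans (-‿cong (∂d τ)) (⁻¹-anti-homo‿- _ _))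

    ~-trans : ∀ {x y z} → x ~ y → y ~ z → x ~ z
    ~-trans {x} {y} {z} (d , ∂d) (e , ∂e) = d +ᶜ e , λ τ → begin
      ∂ (coeff (d +ᶜ e)) τ                             ≈⟨ ∂-+ (coeff d) (coeff e) τ ⟩
      ∂ (coeff d) τ + ∂ (coeff e) τ                    ≈⟨ +-cong (∂d τ) (∂e τ) ⟩
      (x ⟨ τ ⟩ - y ⟨ τ ⟩) + (y ⟨ τ ⟩ - z ⟨ τ ⟩)        ≈⟨ +-assoc _ _ _ ⟩
      x ⟨ τ ⟩ + (- y ⟨ τ ⟩ + (y ⟨ τ ⟩ - z ⟨ τ ⟩))      ≈⟨ +-congˡ (sym (+-assoc _ _ _)) ⟩
      x ⟨ τ ⟩ + (- y ⟨ τ ⟩ + y ⟨ τ ⟩ - z ⟨ τ ⟩)        ≈⟨ +-congˡ (+-congʳ (-‿inverseˡ _)) ⟩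
      x ⟨ τ ⟩ + (0# - z ⟨ τ ⟩)                         ≈⟨ +-congˡ (+-identityˡ _) ⟩
      x ⟨ τ ⟩ - z ⟨ τ ⟩                                ∎

    ⊕-cong : ∀ {x x′ y y′} → x ~ x′ → y ~ y′ → x ⊕ y ~ x′ ⊕ y′
    ⊕-cong (d , ∂d) (e , ∂e) = d +ᶜ e , λ τ →
      trans (∂-+ (coeff d) (coeff e) τ) (trans (+-cong (∂d τ) (∂e τ))
        (trans (interchange _ _ _ _) (+-congˡ (-‿+-comm _ _))))

    ⊝-cong : ∀ {y z} → y ~ z → ⊝ y ~ ⊝ z
    ⊝-cong (d , ∂d) = -ᶜ d , λ τ →
      trans (∂-neg (coeff d) τ) (trans (-‿cong (∂d τ)) (sym (-‿+-comm _ _)))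

    ⊛-cong : ∀ {r s y z} → r ≈ s → y ~ z → r ⊛ y ~ s ⊛ z
    ⊛-cong {r} r≈s (d , ∂d) = r *ᶜ d , λ τ →
      trans (∂-* r (coeff d) τ) (trans (*-congˡ (∂d τ))
        (trans (x[y-z]≈xy-xz r _ _) (+-congˡ (-‿cong (*-congʳ r≈s)))))

open Homology public using () renaming (H̃ to H̃[_])

IsZero : {R : CommutativeRing c ℓ} → Module R m ℓm → Set (m ⊔ ℓm)
IsZero M = ∀ x → x ≈ᴹ 0ᴹ where open Module M

-- Classes may be empty.

record IsPartition (K : Complex N) {n : ℕ} (V : Fin n → Subset N) : Set where
  field
    class⇒vertex : ∀ {i v} → v ∈ V i → Vertex K v
    vertex⇒class : ∀ {v} → Vertex K v → ∃[ i ] v ∈ V i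
    disjoint     : ∀ {i j v} → v ∈ V i → v ∈ V j → i ≡ j

⋃[_]_ : {n : ℕ} → (Fin n → Subset N) → Subset n → Subset N
⋃[ V ] I = ⋃ (map V (filter (_∈? I) (allFin _)))

-- The bijection between Fin (2 ^ N) and Subset N via characteristic functions.

subset : (N : ℕ) → Fin (2 ℕ.^ N) → Subset N
subset N a = tabulate {n = N} λ v → Inverse.to 2↔Bool (finToFun a v)

module _ {N : ℕ} (K : Complex N) {n : ℕ} (V : Fin n → Subset N) where

  Colorful : Subset N → Set
  Colorful σ = Face K σ × (∀ i → Nonempty (σ ∩ V i))

  colorful? : Decidable Colorful
  colorful? σ = face? K σ ×-dec all? λ i → nonempty? (σ ∩ V i)

  IsChain : Subset (2 ℕ.^ N) → Set
  IsChain S = ∀ a b → a ∈ S → b ∈ S → subset N a ⊆ subset N b ⊎ subset N b ⊆ subset N a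

  isChain? : Decidable IsChain
  isChain? S = all? λ a → all? λ b →
    (a ∈? S) →-dec ((b ∈? S) →-dec ((subset N a ⊆? subset N b) ⊎-dec (subset N b ⊆? subset N a)))

  -- The element a of Fin (2 ^ N) stands for the simplex subset N a of K; a
  -- finite set of simplices has the form {σ₁ ⊂ ⋯ ⊂ σₗ} iff it is a chain for ⊆.

  Col : Complex (2 ℕ.^ N)
  Col = record
    { Face   = λ S → (∀ a → a ∈ S → Colorful (subset N a)) × IsChain S
    ; face?  = λ S → (all? λ a → (a ∈? S) →-dec colorful? (subset N a)) ×-dec isChain? S
    ; face-⊥ = (λ _ a∈⊥ → contradiction a∈⊥ ∉⊥) , (λ _ _ a∈⊥ → contradiction a∈⊥ ∉⊥)
    ; face-⊆ = λ S⊆T (colorful , chain) →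
        (λ a a∈S → colorful a (S⊆T a∈S)) , (λ a b a∈S b∈S → chain a b (S⊆T a∈S) (S⊆T b∈S))
    }

{-# OPTIONS --safe #-}
module Submission where

-- Call a simplex rainbow if it meets every class.  The rainbow simplices, graded by
-- dimension, are the cells of a complex (a union of products of simplices) whose
-- barycentric subdivision is Col; its cellular chains are the chains of C modulo those on
-- non-rainbow simplices, with an extra augmentation cell.
--
-- The hypothesis makes the augmented cellular complex exact in one degree: requiring one
-- colour j at a time, the long exact sequence of the pair (C[V_I], C[V_(I - j)]) passes
-- from exactness for I and I - j to exactness relative to the simplices missing j.
--
-- The cellular and simplicial complexes are compared by the double complex of pairs (flag S
-- in Col, cell τ contained in every member of S).  Its rows are exact because over τ the
-- flags form a cone with apex τ.  Its columns over nonempty S are exact because they are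
-- the cellular complex of a simplex, the least member of S, to which the argument above
-- applies; the column over S = ∅ is the cellular complex of C.

open import Defs
open import Algebra.Bundles using (CommutativeRing)
import Algebra.Properties.Ring as RingProperties
import Algebra.Properties.Semiring.Sum as Sum
open import Data.Bool.Base using (if_then_else_)
open import Data.Fin.Base using (Fin; zero; suc; funToFin)
open import Data.Fin.Properties using (2↔Bool; finToFun-funToFin) renaming (_≟_ to _≟ᶠ_)
open import Data.Fin.Subset using (Subset; inside; outside; ⊥; ⁅_⁆; _∈_; _∉_; _⊆_; _∩_; _∪_; _-_; ⋃; ⊤; Nonempty; Empty; ∣_∣)
open import Data.Fin.Subset.Properties using (_∈?_; ∪-identityʳ; p─⊥≡p; p⊆p∪q; q⊆p∪q; x∈p∪q⁺; x∈p∪q⁻; x∈p∩q⁺; x∈p∩q⁻; x∈⁅x⁆; ∉⊥; ∣⊥∣≡0; ∈⊤; ∣⊤∣≡n; x∈⁅y⁆⇒x≡y; p─q⊆p; x∈p∧x≢y⇒x∈p-y; nonempty?; Empty-unique)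
open import Data.Integer.Base as ℤ using (_⊖_)
open import Data.Integer.Properties using (+-injective; distribʳ-⊖-+-pos; [1+m]⊖[1+n]≡m⊖n)
open import Data.List.Base using (List; []; _∷_; length; map; allFin)
open import Data.List.Membership.Propositional using (lose) renaming (_∈_ to _∈ˡ_)
open import Data.List.Membership.Propositional.Properties using (∈-allFin; ∈-filter⁺; ∈-filter⁻)
open import Data.List.Properties using (length-tabulate)
open import Data.List.Relation.Unary.All as All using (All; []; _∷_)
open import Data.List.Relation.Unary.AllPairs using ([]; _∷_)
open import Data.List.Relation.Unary.Any using (Any; here; there)
open import Data.List.Relation.Unary.Unique.Propositional using (Unique)
open import Data.List.Relation.Unary.Unique.Propositional.Properties using (allFin⁺)
open import Data.Maybe.Base using (Maybe; nothing; just)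
open import Data.Nat.Base as ℕ using (ℕ; suc; _≤_; z≤n; s≤s)
import Data.Nat.Properties as ℕ
open import Data.Nat.Properties using (_≟_; suc-injective; +-suc; 1+n≢0; 1+n≰n; m≢1+m+n)
open import Data.Product.Base using (∃-syntax; _×_; _,_; proj₁; proj₂)
open import Data.Sum.Base using (_⊎_; inj₁; inj₂)
open import Data.Unit.Base using () renaming (⊤ to Unit)
open import Data.Vec.Base using ([]; _∷_; here; there; lookup)
open import Data.Vec.Properties using (tabulate-cong; tabulate∘lookup)
open import Function.Base using (_∘_; case_of_)
open import Function.Bundles using (Inverse)
open import Level using (Level; _⊔_)
open import Relation.Binary.PropositionalEquality.Core as ≡ using (_≡_)
open import Relation.Nullary.Decidable using (yes; no; does; ¬?; _×-dec_)
open import Relation.Nullary.Negation using (¬_; contradiction)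
open import Relation.Unary using (Decidable)

private
  variable
    ℓ₁ ℓ₂ : Level
    N : ℕ

-- Sizes of subsets, unions of classes and least members of chains.

∣p∪⁅x⁆∣≡1+∣p∣ : ∀ {p : Subset N} {x} → x ∉ p → ∣ p ∪ ⁅ x ⁆ ∣ ≡ suc ∣ p ∣
∣p∪⁅x⁆∣≡1+∣p∣ {p = inside  ∷ p} {zero}  x∉p = contradiction here x∉p
∣p∪⁅x⁆∣≡1+∣p∣ {p = outside ∷ p} {zero}  x∉p = ≡.cong (suc ∘ ∣_∣) (∪-identityʳ p)
∣p∪⁅x⁆∣≡1+∣p∣ {p = inside  ∷ p} {suc x} x∉p = ≡.cong suc (∣p∪⁅x⁆∣≡1+∣p∣ (x∉p ∘ there))
∣p∪⁅x⁆∣≡1+∣p∣ {p = outside ∷ p} {suc x} x∉p = ∣p∪⁅x⁆∣≡1+∣p∣ (x∉p ∘ there)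

x∈p⇒1+∣p-x∣≡∣p∣ : ∀ {p : Subset N} {x} → x ∈ p → suc ∣ p - x ∣ ≡ ∣ p ∣
x∈p⇒1+∣p-x∣≡∣p∣ {p = inside  ∷ p} here        = ≡.cong (suc ∘ ∣_∣) (p─⊥≡p p)
x∈p⇒1+∣p-x∣≡∣p∣ {p = inside  ∷ p} (there x∈p) = ≡.cong suc (x∈p⇒1+∣p-x∣≡∣p∣ x∈p)
x∈p⇒1+∣p-x∣≡∣p∣ {p = outside ∷ p} (there x∈p) = x∈p⇒1+∣p-x∣≡∣p∣ x∈p

x∉p-x : ∀ (p : Subset N) x → x ∉ p - x
x∉p-x (_ ∷ _) zero    ()
x∉p-x (_ ∷ p) (suc x) (there x∈) = x∉p-x p x x∈

x∈⋃⁺ : ∀ {n} (V : Fin n → Subset N) {x i} {is} → i ∈ˡ is → x ∈ V i → x ∈ ⋃ (map V is)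
x∈⋃⁺ V (here ≡.refl) x∈Vi = x∈p∪q⁺ (inj₁ x∈Vi)
x∈⋃⁺ V (there i∈is)  x∈Vi = x∈p∪q⁺ (inj₂ (x∈⋃⁺ V i∈is x∈Vi))

x∈⋃⁻ : ∀ {n} (V : Fin n → Subset N) {x} is → x ∈ ⋃ (map V is) → ∃[ i ] i ∈ˡ is × x ∈ V i
x∈⋃⁻ V []       x∈ = contradiction x∈ ∉⊥
x∈⋃⁻ V (i ∷ is) x∈ with x∈p∪q⁻ (V i) _ x∈
... | inj₁ x∈Vi = i , here ≡.refl , x∈Vi
... | inj₂ x∈⋃  = let j , j∈is , x∈Vj = x∈⋃⁻ V is x∈⋃ in j , there j∈is , x∈Vj

x∈⋃[]⁺ : ∀ {n} (V : Fin n → Subset N) {I x i} → i ∈ I → x ∈ V i → x ∈ ⋃[ V ] I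
x∈⋃[]⁺ V {I} {i = i} i∈I = x∈⋃⁺ V (∈-filter⁺ (_∈? I) (∈-allFin i) i∈I)

x∈⋃[]⁻ : ∀ {n} (V : Fin n → Subset N) I {x} → x ∈ ⋃[ V ] I → ∃[ i ] i ∈ I × x ∈ V i
x∈⋃[]⁻ V I x∈ = let i , i∈ , x∈Vi = x∈⋃⁻ V _ x∈ in i , proj₂ (∈-filter⁻ (_∈? I) {xs = allFin _} i∈) , x∈Vi

suc[m⊖1+n]≡m⊖n : ∀ m n → ℤ.suc (m ⊖ suc n) ≡ m ⊖ n
suc[m⊖1+n]≡m⊖n m n = ≡.trans (distribʳ-⊖-+-pos 1 m (suc n)) ([1+m]⊖[1+n]≡m⊖n m n)

⊖1-injective : ∀ {m n} → m ⊖ 1 ≡ n ⊖ 1 → m ≡ n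
⊖1-injective {m} {n} eq = +-injective
  (≡.trans (≡.sym (suc[m⊖1+n]≡m⊖n m 0)) (≡.trans (≡.cong ℤ.suc eq) (suc[m⊖1+n]≡m⊖n n 0)))

-- Induction on the index range: a head that belongs to `S` is compared with the least member found
-- in the tail.
chain-least : ∀ {M N} (f : Fin M → Subset N) (S : Subset M) →
  (∀ a b → a ∈ S → b ∈ S → f a ⊆ f b ⊎ f b ⊆ f a) → Nonempty S → ∃[ a ] a ∈ S × (∀ b → b ∈ S → f a ⊆ f b)
chain-least f (s ∷ S) chain nonempty with nonempty? S
chain-least f (s ∷ S) chain (zero  , here)      | no empty = zero , here , λ
  { zero _ v∈ → v∈ ; (suc b) (there b∈S) → contradiction (b , b∈S) empty }
chain-least f (s ∷ S) chain (suc a , there a∈S) | no empty = contradiction (a , a∈S) empty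
chain-least f (s ∷ S) chain _ | yes S-nonempty
  with chain-least (f ∘ suc) S (λ a b a∈S b∈S → chain (suc a) (suc b) (there a∈S) (there b∈S)) S-nonempty
chain-least f (outside ∷ S) chain _ | yes _ | a , a∈S , least = suc a , there a∈S , λ
  { (suc b) (there b∈S) → least b b∈S }
chain-least f (inside ∷ S) chain _ | yes _ | a , a∈S , least with chain zero (suc a) here (there a∈S)
... | inj₁ f0⊆fa = zero , here , λ { zero _ v∈ → v∈ ; (suc b) (there b∈S) v∈ → least b b∈S (f0⊆fa v∈) }
... | inj₂ fa⊆f0 = suc a , there a∈S , λ { zero _ → fa⊆f0 ; (suc b) (there b∈S) → least b b∈S }

code : Subset N → Fin (2 ℕ.^ N)
code τ = funToFin (Inverse.from 2↔Bool ∘ lookup τ)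

subset-code : (τ : Subset N) → subset N (code τ) ≡ τ
subset-code τ = ≡.trans
  (tabulate-cong λ v → ≡.trans (≡.cong (Inverse.to 2↔Bool) (finToFun-funToFin _ v)) (Inverse.strictlyInverseˡ 2↔Bool (lookup τ v)))
  (tabulate∘lookup τ)

-- Linear functionals on chains, the boundary and cones.

module ChainCalculus {c ℓ} (R : CommutativeRing c ℓ) where

  open CommutativeRing R hiding (_-_; zero)
  open RingProperties ring using (-0#≈0#; -1*x≈-x; -‿distribˡ-*; -‿distribʳ-*; -‿involutive; -‿+-comm; x≈y⇒x∙y⁻¹≈ε; x∙y⁻¹≈ε⇒x≈y)
  open Sum semiring using (sum-syntax; sum-cong-≋; sum-replicate-zero)
  open Homology R public using (incidence; ∂; ∂-cong; ∂-+; ∂-*; ∂-0; ∂-neg)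
  open import Relation.Binary.Reasoning.Setoid setoid

  -- Operators are treated one output coefficient at a time, which avoids extensional equality of
  -- chains. By `homo-∑` any such functional passes through the sum that defines `∂`.
  record Linear {X : Set ℓ₁} (L : (X → Carrier) → Carrier) : Set (ℓ₁ ⊔ c ⊔ ℓ) where
    field
      cong   : ∀ {x y} → (∀ σ → x σ ≈ y σ) → L x ≈ L y
      homo-+ : ∀ x y → L (λ σ → x σ + y σ) ≈ L x + L y
      homo-* : ∀ r x → L (λ σ → r * x σ) ≈ r * L x

    homo-0 : ∀ {x} → (∀ σ → x σ ≈ 0#) → L x ≈ 0#
    homo-0 {x} x≈0 = begin
      L x                 ≈⟨ cong (λ σ → trans (x≈0 σ) (sym (zeroˡ _))) ⟩
      L (λ σ → 0# * x σ)  ≈⟨ homo-* 0# x ⟩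
      0# * L x            ≈⟨ zeroˡ _ ⟩
      0#                  ∎

    homo-neg : ∀ x → L (λ σ → - x σ) ≈ - L x
    homo-neg x = begin
      L (λ σ → - x σ)       ≈⟨ cong (λ σ → sym (-1*x≈-x _)) ⟩
      L (λ σ → - 1# * x σ)  ≈⟨ homo-* _ x ⟩
      - 1# * L x            ≈⟨ -1*x≈-x _ ⟩
      - L x                 ∎

    homo-sub : ∀ x y → L (λ σ → x σ + - y σ) ≈ L x + - L y
    homo-sub x y = trans (homo-+ x (λ σ → - y σ)) (+-congˡ (homo-neg y))

    homo-∑ : ∀ {n} (r : Fin n → Carrier) (x : Fin n → X → Carrier) →
      L (λ σ → ∑[ i < n ] (r i * x i σ)) ≈ ∑[ i < n ] (r i * L (x i))
    homo-∑ {ℕ.zero} r x = homo-0 λ _ → refl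
    homo-∑ {suc n}  r x = trans (homo-+ _ _) (+-cong (homo-* _ _) (homo-∑ (r ∘ suc) (x ∘ suc)))

  open Linear public

  eval-linear : {X : Set ℓ₁} (σ : X) → Linear (λ x → x σ)
  eval-linear σ = record { cong = λ x≈y → x≈y σ ; homo-+ = λ _ _ → refl ; homo-* = λ _ _ → refl }

  0-linear : {X : Set ℓ₁} → Linear {X = X} (λ _ → 0#)
  0-linear = record { cong = λ _ → refl ; homo-+ = λ _ _ → sym (+-identityˡ 0#) ; homo-* = λ _ _ → sym (zeroʳ _) }

  ∘-linear : {X : Set ℓ₁} {Y : Set ℓ₂} {L : (Y → Carrier) → Carrier} {T : (X → Carrier) → Y → Carrier} →
    Linear L → (∀ y → Linear (λ x → T x y)) → Linear (L ∘ T)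
  ∘-linear {L = L} {T} lin linT = record
    { cong   = λ x≈y → cong lin (λ σ → cong (linT σ) x≈y)
    ; homo-+ = λ x y → trans (cong lin (λ σ → homo-+ (linT σ) x y)) (homo-+ lin (T x) (T y))
    ; homo-* = λ r x → trans (cong lin (λ σ → homo-* (linT σ) r x)) (homo-* lin r (T x))
    }

  ∂-linear : (τ : Subset N) → Linear (λ x → ∂ x τ)
  ∂-linear τ = record
    { cong = λ x≈y → ∂-cong x≈y τ ; homo-+ = λ x y → ∂-+ x y τ ; homo-* = λ r x → ∂-* r x τ }

  Support : {X : Set ℓ₁} → (X → Set ℓ₂) → (X → Carrier) → Set _
  Support P x = ∀ σ → ¬ P σ → x σ ≈ 0#

  x-0≈x : ∀ {r s} → s ≈ 0# → r + - s ≈ r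
  x-0≈x s≈0 = trans (+-congˡ (trans (-‿cong s≈0) -0#≈0#)) (+-identityʳ _)

  module _ {X : Set ℓ₁} {P : X → Set ℓ₂} (P? : Decidable P) where

    restrict : (X → Carrier) → X → Carrier
    restrict x σ = if does (P? σ) then x σ else 0#

    restrict-yes : ∀ x {σ} → P σ → restrict x σ ≈ x σ
    restrict-yes x {σ} Pσ with P? σ
    ... | yes _  = refl
    ... | no ¬Pσ = contradiction Pσ ¬Pσ

    restrict-vanish : ∀ x {σ} → (P σ → x σ ≈ 0#) → restrict x σ ≈ 0#
    restrict-vanish x {σ} x≈0 with P? σ
    ... | yes Pσ = x≈0 Pσ
    ... | no _   = refl

    restrict-linear : ∀ σ → Linear (λ x → restrict x σ)
    restrict-linear σ with P? σ
    ... | yes _ = eval-linear σ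
    ... | no _  = 0-linear


  restrict-split : {X : Set ℓ₁} {P : X → Set ℓ₂} (P? : Decidable P) →
    ∀ x σ → x σ ≈ restrict P? x σ + restrict (¬? ∘ P?) x σ
  restrict-split P? x σ with P? σ
  ... | yes _ = sym (+-identityʳ _)
  ... | no _  = sym (+-identityˡ _)

  -- With e the first vertex, a chain is e ∧ a + b and its boundary is a - e ∧ ∂a + ∂b. The next two
  -- lemmas are the components of this formula and drive the inductions on `N`.
  ∂-outside : (x : Subset (suc N) → Carrier) (τ : Subset N) →
    ∂ x (outside ∷ τ) ≈ x (inside ∷ τ) + ∂ (x ∘ (outside ∷_)) τ
  ∂-outside x τ = +-congʳ (trans (*-identityˡ _) (reflexive (≡.cong (x ∘ (inside ∷_)) (∪-identityʳ τ))))

  ∂-inside : (x : Subset (suc N) → Carrier) (τ : Subset N) →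
    ∂ x (inside ∷ τ) ≈ - ∂ (x ∘ (inside ∷_)) τ
  ∂-inside {N} x τ = begin
    ∂ x (inside ∷ τ)                               ≈⟨ +-cong (zeroˡ _) (sum-cong-≋ {N} λ v → *-congʳ (sign v)) ⟩
    0# + ∑[ v < N ] (- incidence v τ * xᵢ (τ ∪ ⁅ v ⁆))
                                                   ≈⟨ +-identityˡ _ ⟩
    ∑[ v < N ] (- incidence v τ * xᵢ (τ ∪ ⁅ v ⁆))  ≈⟨ sum-cong-≋ {N} (λ v → swap (incidence v τ) (xᵢ (τ ∪ ⁅ v ⁆))) ⟩
    ∂ (λ σ → - xᵢ σ) τ                             ≈⟨ ∂-neg xᵢ τ ⟩
    - ∂ xᵢ τ                                       ∎
    where
    xᵢ = x ∘ (inside ∷_)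
    swap : ∀ r s → - r * s ≈ r * - s
    swap r s = trans (sym (-‿distribˡ-* r s)) (-‿distribʳ-* r s)
    sign : ∀ v → incidence (suc v) (inside ∷ τ) ≈ - incidence v τ
    sign v with v ∈? τ
    ... | yes _ = sym -0#≈0#
    ... | no _  = -1*x≈-x _

  ∂∂≈0 : (x : Subset N → Carrier) (τ : Subset N) → ∂ (∂ x) τ ≈ 0#
  ∂∂≈0 x [] = refl
  ∂∂≈0 x (inside ∷ τ) = begin
    ∂ (∂ x) (inside ∷ τ)             ≈⟨ ∂-inside (∂ x) τ ⟩
    - ∂ (∂ x ∘ (inside ∷_)) τ        ≈⟨ -‿cong (∂-cong (∂-inside x) τ) ⟩
    - ∂ (λ σ → - ∂ xᵢ σ) τ           ≈⟨ -‿cong (∂-neg (∂ xᵢ) τ) ⟩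
    - - ∂ (∂ xᵢ) τ                   ≈⟨ -‿involutive _ ⟩
    ∂ (∂ xᵢ) τ                       ≈⟨ ∂∂≈0 xᵢ τ ⟩
    0#                               ∎
    where xᵢ = x ∘ (inside ∷_)
  ∂∂≈0 x (outside ∷ τ) = begin
    ∂ (∂ x) (outside ∷ τ)                           ≈⟨ ∂-outside (∂ x) τ ⟩
    ∂ x (inside ∷ τ) + ∂ (∂ x ∘ (outside ∷_)) τ     ≈⟨ +-cong (∂-inside x τ) (∂-cong (∂-outside x) τ) ⟩
    - ∂ xᵢ τ + ∂ (λ σ → xᵢ σ + ∂ xₒ σ) τ            ≈⟨ +-congˡ (∂-+ xᵢ (∂ xₒ) τ) ⟩
    - ∂ xᵢ τ + (∂ xᵢ τ + ∂ (∂ xₒ) τ)                ≈⟨ +-congˡ (+-congˡ (∂∂≈0 xₒ τ)) ⟩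
    - ∂ xᵢ τ + (∂ xᵢ τ + 0#)                        ≈⟨ +-congˡ (+-identityʳ _) ⟩
    - ∂ xᵢ τ + ∂ xᵢ τ                               ≈⟨ -‿inverseˡ _ ⟩
    0#                                              ∎
    where
    xᵢ = x ∘ (inside ∷_)
    xₒ = x ∘ (outside ∷_)

  ∂-vanish : (x : Subset N → Carrier) (τ : Subset N) →
    (∀ v → v ∉ τ → x (τ ∪ ⁅ v ⁆) ≈ 0#) → ∂ x τ ≈ 0#
  ∂-vanish {N} x τ x≈0 = trans (sum-cong-≋ term) (sum-replicate-zero N)
    where
    term : ∀ v → incidence v τ * x (τ ∪ ⁅ v ⁆) ≈ 0#
    term v with v ∈? τ
    ... | yes _  = zeroˡ _
    ... | no v∉τ = trans (*-congˡ (x≈0 v v∉τ)) (zeroʳ _)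

  ∂-support : {P : Subset N → Set ℓ₂} → (∀ {σ τ} → σ ⊆ τ → P τ → P σ) →
    ∀ {x} → Support P x → Support P (∂ x)
  ∂-support P-⊆ {x} x-supp τ ¬Pτ = ∂-vanish x τ λ v _ →
    x-supp (τ ∪ ⁅ v ⁆) (λ Pτv → ¬Pτ (P-⊆ (p⊆p∪q ⁅ v ⁆) Pτv))

  -- Exterior multiplication by v; the signs are those of the incidence numbers.

  cone : Fin N → (Subset N → Carrier) → Subset N → Carrier
  cone zero    x (inside  ∷ τ) = x (outside ∷ τ)
  cone zero    x (outside ∷ τ) = 0#
  cone (suc v) x (inside  ∷ τ) = - cone v (x ∘ (inside ∷_)) τ
  cone (suc v) x (outside ∷ τ) = cone v (x ∘ (outside ∷_)) τ

  -- Up to sign, the coefficient at `τ` is that of `x` at `τ` with `v` deleted. Writing the deletion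
  -- as `ρ ∪ ⁅ v ⁆ ≡ τ` lets callers eliminate `τ` by matching on `≡.refl`.
  cone-vanish : (v : Fin N) (x : Subset N → Carrier) (τ : Subset N) →
    (∀ ρ → v ∉ ρ → ρ ∪ ⁅ v ⁆ ≡ τ → x ρ ≈ 0#) → cone v x τ ≈ 0#
  cone-vanish zero    x (inside  ∷ τ) x≈0 = x≈0 (outside ∷ τ) (λ ()) (≡.cong (inside ∷_) (∪-identityʳ τ))
  cone-vanish zero    x (outside ∷ τ) x≈0 = refl
  cone-vanish (suc v) x (inside  ∷ τ) x≈0 = trans (-‿cong (cone-vanish v _ τ λ ρ v∉ρ eq →
    x≈0 (inside ∷ ρ) (λ { (there v∈ρ) → v∉ρ v∈ρ }) (≡.cong (inside ∷_) eq))) -0#≈0#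
  cone-vanish (suc v) x (outside ∷ τ) x≈0 = cone-vanish v _ τ λ ρ v∉ρ eq →
    x≈0 (outside ∷ ρ) (λ { (there v∈ρ) → v∉ρ v∈ρ }) (≡.cong (outside ∷_) eq)

  cone-linear : (v : Fin N) (τ : Subset N) → Linear (λ x → cone v x τ)
  cone-linear zero    (inside  ∷ τ) = eval-linear (outside ∷ τ)
  cone-linear zero    (outside ∷ τ) = 0-linear
  cone-linear (suc v) (inside  ∷ τ) = record
    { cong   = λ x≈y → -‿cong (cong lin (x≈y ∘ (inside ∷_)))
    ; homo-+ = λ x y → trans (-‿cong (homo-+ lin _ _)) (sym (-‿+-comm _ _))
    ; homo-* = λ r x → trans (-‿cong (homo-* lin r _)) (-‿distribʳ-* _ _)
    }
    where lin = cone-linear v τ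
  cone-linear (suc v) (outside ∷ τ) = record
    { cong   = λ x≈y → cong lin (x≈y ∘ (outside ∷_))
    ; homo-+ = λ x y → homo-+ lin _ _
    ; homo-* = λ r x → homo-* lin r _
    }
    where lin = cone-linear v τ

  -- `∂` is an antiderivation for exterior multiplication, so coning with any `v` is a chain
  -- homotopy from the identity to zero.
  ∂-cone : (v : Fin N) (x : Subset N → Carrier) (τ : Subset N) → ∂ (cone v x) τ + cone v (∂ x) τ ≈ x τ
  ∂-cone zero x (inside ∷ τ) = begin
    ∂ (cone zero x) (inside ∷ τ) + ∂ x (outside ∷ τ)  ≈⟨ +-cong (∂-inside (cone zero x) τ) (∂-outside x τ) ⟩
    - ∂ xₒ τ + (x (inside ∷ τ) + ∂ xₒ τ)              ≈⟨ +-congˡ (+-comm _ _) ⟩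
    - ∂ xₒ τ + (∂ xₒ τ + x (inside ∷ τ))              ≈⟨ +-assoc _ _ _ ⟨
    (- ∂ xₒ τ + ∂ xₒ τ) + x (inside ∷ τ)              ≈⟨ +-congʳ (-‿inverseˡ _) ⟩
    0# + x (inside ∷ τ)                               ≈⟨ +-identityˡ _ ⟩
    x (inside ∷ τ)                                    ∎
    where xₒ = x ∘ (outside ∷_)
  ∂-cone zero x (outside ∷ τ) = begin
    ∂ (cone zero x) (outside ∷ τ) + 0#  ≈⟨ +-identityʳ _ ⟩
    ∂ (cone zero x) (outside ∷ τ)       ≈⟨ ∂-outside (cone zero x) τ ⟩
    x (outside ∷ τ) + ∂ (λ _ → 0#) τ    ≈⟨ +-congˡ (∂-0 τ) ⟩
    x (outside ∷ τ) + 0#                ≈⟨ +-identityʳ _ ⟩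
    x (outside ∷ τ)                     ∎
  ∂-cone (suc v) x (inside ∷ τ) = begin
    ∂ (cone (suc v) x) (inside ∷ τ) + - cone v (∂ x ∘ (inside ∷_)) τ
      ≈⟨ +-cong (∂-inside (cone (suc v) x) τ) (-‿cong (cong (cone-linear v τ) (∂-inside x))) ⟩
    - ∂ (λ σ → - cone v xᵢ σ) τ + - cone v (λ σ → - ∂ xᵢ σ) τ
      ≈⟨ +-cong (-‿cong (∂-neg (cone v xᵢ) τ)) (-‿cong (homo-neg (cone-linear v τ) _)) ⟩
    - - ∂ (cone v xᵢ) τ + - - cone v (∂ xᵢ) τ
      ≈⟨ +-cong (-‿involutive _) (-‿involutive _) ⟩
    ∂ (cone v xᵢ) τ + cone v (∂ xᵢ) τ
      ≈⟨ ∂-cone v xᵢ τ ⟩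
    xᵢ τ ∎
    where xᵢ = x ∘ (inside ∷_)
  ∂-cone (suc v) x (outside ∷ τ) = begin
    ∂ (cone (suc v) x) (outside ∷ τ) + cone v (∂ x ∘ (outside ∷_)) τ
      ≈⟨ +-cong (∂-outside (cone (suc v) x) τ) (cong (cone-linear v τ) (∂-outside x)) ⟩
    (- cone v xᵢ τ + ∂ (cone v xₒ) τ) + cone v (λ σ → xᵢ σ + ∂ xₒ σ) τ
      ≈⟨ +-cong (+-comm _ _) (homo-+ (cone-linear v τ) _ _) ⟩
    (∂ (cone v xₒ) τ + - cone v xᵢ τ) + (cone v xᵢ τ + cone v (∂ xₒ) τ)
      ≈⟨ +-assoc _ _ _ ⟩
    ∂ (cone v xₒ) τ + (- cone v xᵢ τ + (cone v xᵢ τ + cone v (∂ xₒ) τ))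
      ≈⟨ +-congˡ (+-assoc _ _ _) ⟨
    ∂ (cone v xₒ) τ + ((- cone v xᵢ τ + cone v xᵢ τ) + cone v (∂ xₒ) τ)
      ≈⟨ +-congˡ (trans (+-congʳ (-‿inverseˡ _)) (+-identityˡ _)) ⟩
    ∂ (cone v xₒ) τ + cone v (∂ xₒ) τ
      ≈⟨ ∂-cone v xₒ τ ⟩
    xₒ τ ∎
    where
    xᵢ = x ∘ (inside ∷_)
    xₒ = x ∘ (outside ∷_)

  ∂-cone-cycle : (v : Fin N) (x : Subset N → Carrier) → (∀ τ → ∂ x τ ≈ 0#) → ∀ τ → ∂ (cone v x) τ ≈ x τ
  ∂-cone-cycle v x ∂x≈0 τ = begin
    ∂ (cone v x) τ                   ≈⟨ +-identityʳ _ ⟨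
    ∂ (cone v x) τ + 0#              ≈⟨ +-congˡ (homo-0 (cone-linear v τ) ∂x≈0) ⟨
    ∂ (cone v x) τ + cone v (∂ x) τ  ≈⟨ ∂-cone v x τ ⟩
    x τ                              ∎

  -- Colours and the augmentation of the cellular complex.

  module Colours {k N : ℕ} (V : Fin k → Subset N) where

    Meets : Fin k → Subset N → Set
    Meets j τ = Nonempty (τ ∩ V j)

    meets? : ∀ j → Decidable (Meets j)
    meets? j τ = nonempty? (τ ∩ V j)

    meets-⊆ : ∀ {j σ τ} → σ ⊆ τ → Meets j σ → Meets j τ
    meets-⊆ {j} {σ} σ⊆τ (v , v∈) = let v∈σ , v∈Vj = x∈p∩q⁻ σ (V j) v∈ in v , x∈p∩q⁺ (σ⊆τ v∈σ , v∈Vj)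

    Rainbow : List (Fin k) → Subset N → Set
    Rainbow js τ = All (λ j → Meets j τ) js

    rainbow-⊆ : ∀ {js σ τ} → σ ⊆ τ → Rainbow js σ → Rainbow js τ
    rainbow-⊆ σ⊆τ = All.map (meets-⊆ σ⊆τ)

    Within : List (Fin k) → Subset N → Set
    Within js τ = ∀ {v} → v ∈ τ → Any (λ j → v ∈ V j) js

    within-off : ∀ {j js τ} → ¬ Meets j τ → Within (j ∷ js) τ → Within js τ
    within-off ¬meets within v∈τ with within v∈τ
    ... | here v∈Vj   = contradiction (_ , x∈p∩q⁺ (v∈τ , v∈Vj)) ¬meets
    ... | there v∈js  = v∈js

    on off : Fin k → (Subset N → Carrier) → Subset N → Carrier
    on  j = restrict (meets? j)
    off j = restrict (¬? ∘ meets? j)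

    -- Deletes one vertex of each colour in turn, with signs.  Only simplices with exactly
    -- one vertex of each colour in js contribute.

    aug : List (Fin k) → (Subset N → Carrier) → Carrier
    aug []       x = x ⊥
    aug (j ∷ js) x = aug js (off j (∂ (on j x)))

    off-∂-on-linear : ∀ j τ → Linear (λ x → off j (∂ (on j x)) τ)
    off-∂-on-linear j τ =
      ∘-linear (restrict-linear (¬? ∘ meets? j) τ) λ σ → ∘-linear (∂-linear σ) (restrict-linear (meets? j))

    aug-linear : ∀ js → Linear (aug js)
    aug-linear []       = eval-linear ⊥
    aug-linear (j ∷ js) = ∘-linear (aug-linear js) (off-∂-on-linear j)

    -- Supersets of rainbow simplices are rainbow, so each deletion reads only simplices meeting one
    -- more colour. Hence the augmentation descends to chains modulo non-rainbow simplices.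
    aug-vanish : ∀ js x → (∀ τ → Rainbow js τ → x τ ≈ 0#) → aug js x ≈ 0#
    aug-vanish []       x x≈0 = x≈0 ⊥ []
    aug-vanish (j ∷ js) x x≈0 = aug-vanish js _ λ τ rainbow →
      restrict-vanish (¬? ∘ meets? j) (∂ (on j x)) λ _ → ∂-vanish (on j x) τ λ v _ →
        restrict-vanish (meets? j) x λ meets → x≈0 (τ ∪ ⁅ v ⁆) (meets ∷ rainbow-⊆ (p⊆p∪q ⁅ v ⁆) rainbow)

    aug-cong-rainbow : ∀ js x y → (∀ τ → Rainbow js τ → x τ ≈ y τ) → aug js x ≈ aug js y
    aug-cong-rainbow js x y x≈y = x∙y⁻¹≈ε⇒x≈y _ _ (trans (sym (homo-sub (aug-linear js) x y))
      (aug-vanish js _ λ τ rainbow → x≈y⇒x∙y⁻¹≈ε (x≈y τ rainbow)))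

    aug-vanish-size : ∀ js x → (∀ τ → ∣ τ ∣ ≡ length js → x τ ≈ 0#) → aug js x ≈ 0#
    aug-vanish-size []       x x≈0 = x≈0 ⊥ (∣⊥∣≡0 N)
    aug-vanish-size (j ∷ js) x x≈0 = aug-vanish-size js _ λ τ size →
      restrict-vanish (¬? ∘ meets? j) (∂ (on j x)) λ _ → ∂-vanish (on j x) τ λ v v∉τ →
        restrict-vanish (meets? j) x λ _ → x≈0 (τ ∪ ⁅ v ⁆) (≡.trans (∣p∪⁅x⁆∣≡1+∣p∣ v∉τ) (≡.cong suc size))

    off-∂-off : ∀ j x τ → off j (∂ (off j x)) τ ≈ ∂ (off j x) τ
    off-∂-off j x τ with meets? j τ
    ... | no _      = refl
    ... | yes meets = sym (∂-vanish (off j x) τ λ v _ → restrict-vanish (¬? ∘ meets? j) x λ ¬meets →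
      contradiction (meets-⊆ (p⊆p∪q ⁅ v ⁆) meets) ¬meets)

    off-∂-split : ∀ j x τ → off j (∂ x) τ ≈ off j (∂ (on j x)) τ + ∂ (off j x) τ
    off-∂-split j x τ = begin
      off j (∂ x) τ                                     ≈⟨ cong lin (∂-cong (restrict-split (meets? j) x)) ⟩
      off j (∂ (λ σ → on j x σ + off j x σ)) τ          ≈⟨ cong lin (∂-+ (on j x) (off j x)) ⟩
      off j (λ σ → ∂ (on j x) σ + ∂ (off j x) σ) τ      ≈⟨ homo-+ lin (∂ (on j x)) (∂ (off j x)) ⟩
      off j (∂ (on j x)) τ + off j (∂ (off j x)) τ      ≈⟨ +-congˡ (off-∂-off j x τ) ⟩
      off j (∂ (on j x)) τ + ∂ (off j x) τ              ∎
      where lin = restrict-linear (¬? ∘ meets? j) τ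

    -- By `aug-∷` the colour `j` can be deleted from `∂ x` without first selecting the simplices
    -- that meet `j`, and then `∂∂≈0` applies. In turn, `aug-∷` discards the boundary of the part
    -- missing `j`, which `aug-∂` kills for the shorter list. With no colours left, `Within []`
    -- excludes every vertex.
    aug-∂ : ∀ js x → Support (Within js) x → aug js (∂ x) ≈ 0#

    aug-∷ : ∀ j js x → Support (Within (j ∷ js)) x → aug (j ∷ js) x ≈ aug js (off j (∂ x))
    aug-∷ j js x x-supp = sym (begin
      aug js (off j (∂ x))                                  ≈⟨ cong (aug-linear js) (off-∂-split j x) ⟩
      aug js (λ τ → off j (∂ (on j x)) τ + ∂ (off j x) τ)   ≈⟨ homo-+ (aug-linear js) _ _ ⟩
      aug (j ∷ js) x + aug js (∂ (off j x))                 ≈⟨ +-congˡ (aug-∂ js (off j x) λ σ ¬within →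
        restrict-vanish (¬? ∘ meets? j) x λ ¬meets → x-supp σ λ within → ¬within (within-off ¬meets within)) ⟩
      aug (j ∷ js) x + 0#                                   ≈⟨ +-identityʳ _ ⟩
      aug (j ∷ js) x                                        ∎)

    aug-∂ []       x x-supp = ∂-vanish x ⊥ λ v _ → x-supp (⊥ ∪ ⁅ v ⁆) λ within →
      case within (q⊆p∪q ⊥ ⁅ v ⁆ (x∈⁅x⁆ v)) of λ ()
    aug-∂ (j ∷ js) x x-supp = trans
      (aug-∷ j js (∂ x) (∂-support {P = Within (j ∷ js)} (λ σ⊆τ within v∈σ → within (σ⊆τ v∈σ)) x-supp))
      (homo-0 (aug-linear js) λ τ → restrict-vanish (¬? ∘ meets? j) (∂ (∂ x)) λ _ → ∂∂≈0 x τ)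

    -- Exactness relative to the non-rainbow simplices.

    In : (Subset N → Set) → Subset k → Subset N → Set
    In F I σ = F σ × σ ⊆ ⋃[ V ] I

    -- Vanishing of reduced homology in degree `∣ I ∣ + m - 2`, with dimensions replaced by numbers
    -- of vertices. A predicate `F` stands for the complex, so that the simplices below a flag are
    -- covered as well as those of `C`.
    Fillable : (Subset N → Set) → Subset k → ℕ → Set (c ⊔ ℓ)
    Fillable F I m = ∀ x → Support (λ σ → In F I σ × suc ∣ σ ∣ ≡ ∣ I ∣ ℕ.+ m) x → (∀ τ → ∂ x τ ≈ 0#) →
      ∃[ e ] Support (λ σ → In F I σ × ∣ σ ∣ ≡ ∣ I ∣ ℕ.+ m) e × (∀ τ → ∂ e τ ≈ x τ)

    module Filling (disjoint : ∀ {i j v} → v ∈ V i → v ∈ V j → i ≡ j)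
                   (F : Subset N → Set) (F-⊆ : ∀ {σ τ} → σ ⊆ τ → F τ → F σ) where

      off-⊆ : ∀ {I : Subset k} {j σ} → ¬ Meets j σ → σ ⊆ ⋃[ V ] I → σ ⊆ ⋃[ V ] (I - j)
      off-⊆ {I} {j} ¬meets σ⊆ {v} v∈σ = let i , i∈I , v∈Vi = x∈⋃[]⁻ V I (σ⊆ v∈σ) in
        x∈⋃[]⁺ V (x∈p∧x≢y⇒x∈p-y i∈I λ i≡j →
          ¬meets (v , x∈p∩q⁺ (v∈σ , ≡.subst (λ i → v ∈ V i) i≡j v∈Vi))) v∈Vi

      meets-⊈ : ∀ {I : Subset k} {j σ} → Meets j σ → ¬ (σ ⊆ ⋃[ V ] (I - j))
      meets-⊈ {I} {j} {σ} (v , v∈) σ⊆ =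
        let v∈σ , v∈Vj    = x∈p∩q⁻ σ (V j) v∈
            i , i∈ , v∈Vi = x∈⋃[]⁻ V (I - j) (σ⊆ v∈σ)
        in x∉p-x I j (≡.subst (_∈ I - j) (disjoint v∈Vi v∈Vj) i∈)

      -⊆ : ∀ (I : Subset k) j σ → σ ⊆ ⋃[ V ] (I - j) → σ ⊆ ⋃[ V ] I
      -⊆ I j σ σ⊆ v∈σ = let i , i∈ , v∈Vi = x∈⋃[]⁻ V (I - j) (σ⊆ v∈σ) in x∈⋃[]⁺ V (p─q⊆p I ⁅ j ⁆ i∈) v∈Vi

      1+∣I-j∣+m : ∀ {I : Subset k} {j} m → j ∈ I → suc (∣ I - j ∣ ℕ.+ m) ≡ ∣ I ∣ ℕ.+ m
      1+∣I-j∣+m m j∈I = ≡.cong (ℕ._+ m) (x∈p⇒1+∣p-x∣≡∣p∣ j∈I)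

      In-within : ∀ {I : Subset k} {js σ} → (∀ {i} → i ∈ I → i ∈ˡ js) → In F I σ → Within js σ
      In-within {I} I⊆js (_ , σ⊆) v∈σ = let i , i∈I , v∈Vi = x∈⋃[]⁻ V I (σ⊆ v∈σ) in lose (I⊆js i∈I) v∈Vi

      ∈-remove : ∀ {I : Subset k} {j js} → All (λ i → ¬ j ≡ i) js → (∀ {i} → i ∈ˡ j ∷ js → i ∈ I) → ∀ {i} → i ∈ˡ js → i ∈ I - j
      ∈-remove j∉js js⊆I i∈js = x∈p∧x≢y⇒x∈p-y (js⊆I (there i∈js)) λ i≡j → All.lookup j∉js i∈js (≡.sym i≡j)

      insert-∈ : ∀ {I : Subset k} {j js} → (∀ {i} → i ∈ I - j → i ∈ˡ js) → ∀ {i} → i ∈ I → i ∈ˡ j ∷ js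
      insert-∈ {j = j} I-j⊆js {i} i∈I with i ≟ᶠ j
      ... | yes i≡j = here i≡j
      ... | no i≢j  = there (I-j⊆js (x∈p∧x≢y⇒x∈p-y i∈I i≢j))

      -- The augmentation matters only for I = js: there the cube of subcomplexes C[V_I] has
      -- the vertex C[∅], about which nothing is assumed.

      fill : ∀ m → (∀ I → Nonempty I → Fillable F I m) →
        ∀ js I → Unique js → (∀ {j} → j ∈ˡ js → j ∈ I) →
        ∀ x → Support (λ σ → In F I σ × suc ∣ σ ∣ ≡ ∣ I ∣ ℕ.+ m) x → (∀ τ → Rainbow js τ → ∂ x τ ≈ 0#) →
        ((∀ {i} → i ∈ I → i ∈ˡ js) → aug js x ≈ 0#) →
        ∃[ e ] Support (λ σ → In F I σ × ∣ σ ∣ ≡ ∣ I ∣ ℕ.+ m) e × (∀ τ → Rainbow js τ → ∂ e τ ≈ x τ)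
      fill m fillable [] I _ _ x x-supp cycle augmented with nonempty? I
      ... | yes nonempty = let e , e-supp , ∂e = fillable I nonempty x x-supp (λ τ → cycle τ []) in
        e , e-supp , λ τ _ → ∂e τ
      -- With `I` empty the only possible face is `⊥`, whose coefficient is `aug [] x`; the
      -- condition on the augmentation makes it zero.
      ... | no empty     = (λ _ → 0#) , (λ _ _ → refl) , λ τ _ → trans (∂-0 τ) (sym (x≈0 τ))
        where
        x≈0 : ∀ τ → x τ ≈ 0#
        x≈0 τ with nonempty? τ
        ... | yes (v , v∈τ) = x-supp τ λ { ((_ , τ⊆) , _) →
          let i , i∈I , _ = x∈⋃[]⁻ V I (τ⊆ v∈τ) in empty (i , i∈I) }
        ... | no τ-empty    = ≡.subst (λ τ → x τ ≈ 0#) (≡.sym (Empty-unique τ-empty))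
          (augmented λ i∈I → contradiction (_ , i∈I) empty)
      fill m fillable (j ∷ js) I (j∉js ∷ unique) js⊆I x x-supp cycle augmented =
        e , e-supp , λ τ → λ { (meets ∷ rainbow) → trans (∂e τ rainbow)
          (x-0≈x (e′-supp τ λ { ((_ , τ⊆) , _) → meets-⊈ {I} {j} {τ} meets τ⊆ })) }
        where
        j∈I : j ∈ I
        j∈I = js⊆I (here ≡.refl)

        -- This is the connecting homomorphism of the pair: the part of `∂ x` missing `j` lies over
        -- `I - j`. Both the size and the number of colours drop by one, so `m` is unchanged.
        b-supp : Support (λ σ → In F (I - j) σ × suc ∣ σ ∣ ≡ ∣ I - j ∣ ℕ.+ m) (off j (∂ x))
        b-supp σ ¬P = restrict-vanish (¬? ∘ meets? j) (∂ x) λ ¬meets → ∂-vanish x σ λ v v∉σ →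
          x-supp (σ ∪ ⁅ v ⁆) λ { ((Fσv , σv⊆) , size) → ¬P
            ( (F-⊆ (p⊆p∪q ⁅ v ⁆) Fσv , off-⊆ {I} {j} {σ} ¬meets (λ u∈σ → σv⊆ (p⊆p∪q ⁅ v ⁆ u∈σ)))
            , suc-injective (≡.trans (≡.trans (≡.cong suc (≡.sym (∣p∪⁅x⁆∣≡1+∣p∣ v∉σ))) size)
                (≡.sym (1+∣I-j∣+m m j∈I))) ) }

        -- In `∂ (∂ x)` the simplices meeting `j` contribute nothing: above a `js`-rainbow `τ` they
        -- are rainbow for `j ∷ js`, where `∂ x` vanishes.
        b-cycle : ∀ τ → Rainbow js τ → ∂ (off j (∂ x)) τ ≈ 0#
        b-cycle τ rainbow = begin
          ∂ (off j (∂ x)) τ                          ≈⟨ +-identityˡ _ ⟨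
          0# + ∂ (off j (∂ x)) τ                     ≈⟨ +-congʳ (∂-vanish (on j (∂ x)) τ λ v _ →
            restrict-vanish (meets? j) (∂ x) λ meets → cycle (τ ∪ ⁅ v ⁆) (meets ∷ rainbow-⊆ (p⊆p∪q ⁅ v ⁆) rainbow)) ⟨
          ∂ (on j (∂ x)) τ + ∂ (off j (∂ x)) τ       ≈⟨ ∂-+ (on j (∂ x)) (off j (∂ x)) τ ⟨
          ∂ (λ σ → on j (∂ x) σ + off j (∂ x) σ) τ   ≈⟨ ∂-cong (restrict-split (meets? j) (∂ x)) τ ⟨
          ∂ (∂ x) τ                                  ≈⟨ ∂∂≈0 x τ ⟩
          0#                                         ∎

        b-augmented : (∀ {i} → i ∈ I - j → i ∈ˡ js) → aug js (off j (∂ x)) ≈ 0#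
        b-augmented I-j⊆js = trans
          (sym (aug-∷ j js x λ σ ¬within → x-supp σ λ { (inI , _) → ¬within (In-within (insert-∈ I-j⊆js) inI) }))
          (augmented (insert-∈ I-j⊆js))

        first = fill m fillable js (I - j) unique (∈-remove j∉js js⊆I) (off j (∂ x)) b-supp b-cycle b-augmented
        e′ = proj₁ first
        e′-supp = proj₁ (proj₂ first)
        ∂e′ = proj₂ (proj₂ first)

        -- Subtracting `e′` cancels the part of `∂ x` missing `j`, so only the colours `js` are
        -- still required. As `e′` lives on simplices missing `j`, it vanishes on those rainbow for
        -- `j ∷ js`.
        y : Subset N → Carrier
        y σ = x σ + - e′ σ

        y-supp : Support (λ σ → In F I σ × suc ∣ σ ∣ ≡ ∣ I ∣ ℕ.+ m) y
        y-supp σ ¬P = trans (x-0≈x (e′-supp σ λ { ((Fσ , σ⊆) , size) →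
          ¬P ((Fσ , λ {v} → -⊆ I j σ σ⊆ {v}) , ≡.trans (≡.cong suc size) (1+∣I-j∣+m m j∈I)) })) (x-supp σ ¬P)

        y-cycle : ∀ τ → Rainbow js τ → ∂ y τ ≈ 0#
        y-cycle τ rainbow = trans (homo-sub (∂-linear τ) x e′) (x≈y⇒x∙y⁻¹≈ε ∂x≈∂e′)
          where
          ∂x≈∂e′ : ∂ x τ ≈ ∂ e′ τ
          ∂x≈∂e′ with meets? j τ
          ... | yes meets = trans (cycle τ (meets ∷ rainbow)) (sym (∂-vanish e′ τ λ v _ →
            e′-supp (τ ∪ ⁅ v ⁆) λ { ((_ , τv⊆) , _) → meets-⊈ {I} {j} {τ ∪ ⁅ v ⁆} (meets-⊆ (p⊆p∪q ⁅ v ⁆) meets) τv⊆ }))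
          ... | no ¬meets = sym (trans (∂e′ τ rainbow) (restrict-yes (¬? ∘ meets? j) (∂ x) ¬meets))

        -- The condition on the augmentation is vacuous here: `j` is in `I` but not in `js`.
        second = fill m fillable js I unique (js⊆I ∘ there) y y-supp y-cycle λ I⊆js →
          contradiction ≡.refl (All.lookup j∉js (I⊆js j∈I))
        e = proj₁ second
        e-supp = proj₁ (proj₂ second)
        ∂e = proj₂ (proj₂ second)

      -- Surjectivity of the augmentation, by running the connecting homomorphism backwards: a chain
      -- with value `r` over `I - j` is filled over `I`, and `aug-∷` carries the value to the
      -- filling. As the list enumerates `I`, the recursion ends with `r` placed on `⊥`.
      augment : F ⊥ → (∀ I → Nonempty I → Fillable F I 0) →
        ∀ js I → Unique js → (∀ {j} → j ∈ˡ js → j ∈ I) → (∀ {i} → i ∈ I → i ∈ˡ js) → ∀ r →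
        ∃[ e ] Support (λ σ → In F I σ × ∣ σ ∣ ≡ ∣ I ∣ ℕ.+ 0) e × aug js e ≈ r × (∀ τ → Rainbow js τ → ∂ e τ ≈ 0#)
      augment F⊥ fillable [] I _ _ I⊆[] r = e , e-supp , e⊥≈r , ∂e
        where
        empty? = λ (σ : Subset N) → ¬? (nonempty? σ)
        e = restrict empty? (λ _ → r)

        e⊥≈r : e ⊥ ≈ r
        e⊥≈r = restrict-yes empty? (λ _ → r) λ { (v , v∈⊥) → ∉⊥ v∈⊥ }

        I≡⊥ : I ≡ ⊥
        I≡⊥ = Empty-unique λ { (i , i∈I) → case I⊆[] i∈I of λ () }

        e-supp : Support (λ σ → In F I σ × ∣ σ ∣ ≡ ∣ I ∣ ℕ.+ 0) e
        e-supp σ ¬P = restrict-vanish empty? (λ _ → r) λ empty → contradiction (P⊥ (Empty-unique empty)) ¬P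
          where
          P⊥ : σ ≡ ⊥ → In F I σ × ∣ σ ∣ ≡ ∣ I ∣ ℕ.+ 0
          P⊥ ≡.refl rewrite I≡⊥ | ∣⊥∣≡0 N | ∣⊥∣≡0 k = (F⊥ , λ v∈⊥ → contradiction v∈⊥ ∉⊥) , ≡.refl

        ∂e : ∀ τ → Rainbow [] τ → ∂ e τ ≈ 0#
        ∂e τ _ = ∂-vanish e τ λ v _ → restrict-vanish empty? (λ _ → r) λ empty →
          contradiction (v , q⊆p∪q τ ⁅ v ⁆ (x∈⁅x⁆ v)) empty
      augment F⊥ fillable (j ∷ js) I (j∉js ∷ unique) js⊆I I⊆js r = e , e-supp , aug-e , λ τ → λ
        { (meets ∷ rainbow) → trans (∂e τ rainbow) (e′≈0 meets) }
        where
        j∈I : j ∈ I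
        j∈I = js⊆I (here ≡.refl)

        first = augment F⊥ fillable js (I - j) unique (∈-remove j∉js js⊆I) I-j⊆js r
          where
          I-j⊆js : ∀ {i} → i ∈ I - j → i ∈ˡ js
          I-j⊆js i∈ with I⊆js (p─q⊆p I ⁅ j ⁆ i∈)
          ... | here ≡.refl = contradiction i∈ (x∉p-x I j)
          ... | there i∈js  = i∈js
        e′ = proj₁ first
        e′-supp = proj₁ (proj₂ first)
        aug-e′ = proj₁ (proj₂ (proj₂ first))
        ∂e′ = proj₂ (proj₂ (proj₂ first))

        e′≈0 : ∀ {τ} → Meets j τ → e′ τ ≈ 0#
        e′≈0 {τ} meets = e′-supp τ λ { ((_ , τ⊆) , _) → meets-⊈ {I} {j} {τ} meets τ⊆ }

        second = fill 0 fillable js I unique (js⊆I ∘ there) e′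
          (λ σ ¬P → e′-supp σ λ { ((Fσ , σ⊆) , size) →
            ¬P ((Fσ , λ {v} → -⊆ I j σ σ⊆ {v}) , ≡.trans (≡.cong suc size) (1+∣I-j∣+m 0 j∈I)) })
          ∂e′ (λ I⊆js′ → contradiction ≡.refl (All.lookup j∉js (I⊆js′ j∈I)))
        e = proj₁ second
        e-supp = proj₁ (proj₂ second)
        ∂e = proj₂ (proj₂ second)

        aug-e : aug (j ∷ js) e ≈ r
        aug-e = begin
          aug (j ∷ js) e        ≈⟨ aug-∷ j js e (λ σ ¬within → e-supp σ λ { (inI , _) → ¬within (In-within I⊆js inI) }) ⟩
          aug js (off j (∂ e))  ≈⟨ aug-cong-rainbow js (off j (∂ e)) e′ off-∂e≈e′ ⟩
          aug js e′             ≈⟨ aug-e′ ⟩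
          r                     ∎
          where
          off-∂e≈e′ : ∀ τ → Rainbow js τ → off j (∂ e) τ ≈ e′ τ
          off-∂e≈e′ τ rainbow with meets? j τ
          ... | yes meets = sym (e′≈0 meets)
          ... | no _      = ∂e τ rainbow

  -- Columns: the cellular complexes of `C` and of its simplices.

  module _ {k N : ℕ} (C : Complex N) (V : Fin k → Subset N) (partition : IsPartition C V)
           (m : ℕ) (fillable : ∀ I → Nonempty I → Colours.Fillable V (Face C) I m) where

    open Colours V
    open IsPartition partition

    private
      K : Complex (2 ℕ.^ N)
      K = Col C V

      Flag : Set
      Flag = Subset (2 ℕ.^ N)

      js : List (Fin k)
      js = allFin k

    -- For the empty flag this is all of `C`; for a nonempty flag, the full simplex on its least
    -- member.
    Under : Flag → Subset N → Set
    Under S τ = Face C τ × (∀ a → a ∈ S → τ ⊆ subset N a)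

    under-⊆ : ∀ {S σ τ} → σ ⊆ τ → Under S τ → Under S σ
    under-⊆ σ⊆τ (Cτ , τ⊆S) = face-⊆ C σ⊆τ Cτ , λ a a∈S v∈σ → τ⊆S a a∈S (σ⊆τ v∈σ)

    class : ∀ {σ v} → Face C σ → v ∈ σ → ∃[ i ] v ∈ V i
    class {σ} {v} Cσ v∈σ = vertex⇒class (face-⊆ C (λ u∈⁅v⁆ → ≡.subst (_∈ σ) (≡.sym (x∈⁅y⁆⇒x≡y v u∈⁅v⁆)) v∈σ) Cσ)

    ⊆⋃⊤ : ∀ {σ} → Face C σ → σ ⊆ ⋃[ V ] ⊤
    ⊆⋃⊤ Cσ v∈σ = let i , v∈Vi = class Cσ v∈σ in x∈⋃[]⁺ V ∈⊤ v∈Vi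

    within : ∀ {σ} → Face C σ → Within js σ
    within Cσ v∈σ = let i , v∈Vi = class Cσ v∈σ in lose (∈-allFin i) v∈Vi

    -- Classes are disjoint, so deleting the vertex chosen for `j` keeps those chosen for the other
    -- colours.
    rainbow-size : ∀ {js τ} → Unique js → Rainbow js τ → length js ≤ ∣ τ ∣
    rainbow-size []              []                   = z≤n
    rainbow-size {j ∷ js} {τ} (j∉js ∷ unique) ((v , v∈) ∷ rainbow) =
      ≡.subst (suc (length js) ≤_) (x∈p⇒1+∣p-x∣≡∣p∣ v∈τ) (s≤s (rainbow-size unique (All.zipWith remove (j∉js , rainbow))))
      where
      v∈τ = proj₁ (x∈p∩q⁻ τ (V j) v∈)
      v∈Vj = proj₂ (x∈p∩q⁻ τ (V j) v∈)
      remove : ∀ {i} → (¬ j ≡ i) × Meets i τ → Meets i (τ - v)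
      remove {i} (j≢i , u , u∈) = let u∈τ , u∈Vi = x∈p∩q⁻ τ (V i) u∈ in
        u , x∈p∩q⁺ (x∈p∧x≢y⇒x∈p-y u∈τ (λ u≡v → j≢i (disjoint v∈Vj (≡.subst (_∈ V i) u≡v u∈Vi))) , u∈Vi)

    -- Under a nonempty flag lies a full simplex, which is acyclic in every degree. For the empty
    -- flag fillings come from the hypothesis, which fixes the degree `q ≡ m`.
    under-fillable : ∀ {S} q → Face K S → Nonempty S ⊎ (Empty S × q ≡ m) → ∀ I → Nonempty I → Fillable (Under S) I q
    under-fillable {S} q _ (inj₂ (S-empty , ≡.refl)) I nonempty x x-supp cycle =
      let e , e-supp , ∂e = fillable I nonempty x (λ σ ¬P → x-supp σ λ { (((Cσ , _) , σ⊆) , size) →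
                              ¬P ((Cσ , λ {v} → σ⊆ {v}) , size) }) cycle
      in e , (λ σ ¬P → e-supp σ λ { ((Cσ , σ⊆) , size) →
            ¬P (((Cσ , λ a a∈S → contradiction (a , a∈S) S-empty) , λ {v} → σ⊆ {v}) , size) }) , ∂e
    under-fillable {S} q (colorful , chain) (inj₁ S-nonempty) I (i , i∈I) x x-supp cycle =
      cone v x , supp , ∂-cone-cycle v x cycle
      where
      least = chain-least (subset N) S chain S-nonempty
      a = proj₁ least
      a∈S = proj₁ (proj₂ least)
      -- The apex has a colour in `I` and lies in the least member, so coning stays within
      -- `⋃[ V ] I` and under every member of `S`.
      v = proj₁ (proj₂ (colorful a a∈S) i)
      v∈ = x∈p∩q⁻ (subset N a) (V i) (proj₂ (proj₂ (colorful a a∈S) i))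

      insert-⊆ : ∀ {ρ X : Subset N} → ρ ⊆ X → v ∈ X → ρ ∪ ⁅ v ⁆ ⊆ X
      insert-⊆ {ρ} {X} ρ⊆X v∈X u∈ with x∈p∪q⁻ ρ ⁅ v ⁆ u∈
      ... | inj₁ u∈ρ   = ρ⊆X u∈ρ
      ... | inj₂ u∈⁅v⁆ = ≡.subst (_∈ X) (≡.sym (x∈⁅y⁆⇒x≡y v u∈⁅v⁆)) v∈X

      supp : Support (λ σ → In (Under S) I σ × ∣ σ ∣ ≡ ∣ I ∣ ℕ.+ q) (cone v x)
      supp σ ¬P = cone-vanish v x σ λ { ρ v∉ρ ≡.refl → x-supp ρ λ { (((Cρ , ρ⊆S) , ρ⊆) , size) → ¬P
        ( ( ( face-⊆ C (insert-⊆ {ρ} (ρ⊆S a a∈S) (proj₁ v∈)) (proj₁ (colorful a a∈S))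
            , λ b b∈S → insert-⊆ {ρ} (ρ⊆S b b∈S) (proj₂ (proj₂ least) b b∈S (proj₁ v∈)) )
          , λ {u} → insert-⊆ {ρ} ρ⊆ (x∈⋃[]⁺ V i∈I (proj₂ v∈)) {u} )
        , ≡.trans (∣p∪⁅x⁆∣≡1+∣p∣ v∉ρ) size ) } }

    -- The cell nothing is the target of the augmentation.

    Cell : Set
    Cell = Maybe (Subset N)

    -- Cellular chains are compared on good cells only: this is the quotient by the chains on
    -- non-rainbow simplices.

    Good : Cell → Set
    Good nothing  = Unit
    Good (just τ) = Rainbow js τ

    -- A rainbow `τ` is a product of simplices of total dimension `∣ τ ∣ - k`. Degrees are one more
    -- than this, which leaves 0 for the augmentation cell.
    At : ℕ → Cell → Set
    At q nothing  = q ≡ 0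
    At q (just τ) = suc ∣ τ ∣ ≡ k ℕ.+ q

    Carries : Flag → Cell → Set
    Carries S nothing  = Unit
    Carries S (just τ) = Under S τ

    ∂ᵛ : (Cell → Carrier) → Cell → Carrier
    ∂ᵛ x nothing  = aug js (x ∘ just)
    ∂ᵛ x (just τ) = ∂ (x ∘ just) τ

    ∂ᵛ-linear : ∀ cell → Linear (λ x → ∂ᵛ x cell)
    ∂ᵛ-linear nothing  = ∘-linear (aug-linear js) (eval-linear ∘ just)
    ∂ᵛ-linear (just τ) = ∘-linear (∂-linear τ) (eval-linear ∘ just)

    infix 4 _≋_
    _≋_ : (Cell → Carrier) → (Cell → Carrier) → Set ℓ
    x ≋ y = ∀ cell → Good cell → x cell ≈ y cell

    𝟎 : Cell → Carrier
    𝟎 _ = 0#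

    ∂ᵛ-cong : ∀ {x y} → x ≋ y → ∂ᵛ x ≋ ∂ᵛ y
    ∂ᵛ-cong {x} {y} x≋y nothing  _       = aug-cong-rainbow js (x ∘ just) (y ∘ just) λ τ → x≋y (just τ)
    ∂ᵛ-cong {x} {y} x≋y (just τ) rainbow = x∙y⁻¹≈ε⇒x≈y _ _ (trans
      (sym (homo-sub (∂-linear τ) (x ∘ just) (y ∘ just)))
      (∂-vanish (λ σ → x (just σ) + - y (just σ)) τ λ v _ → x≈y⇒x∙y⁻¹≈ε (x≋y (just (τ ∪ ⁅ v ⁆)) (rainbow-⊆ (p⊆p∪q ⁅ v ⁆) rainbow))))

    ∂ᵛ∂ᵛ≋0 : ∀ x → Support (Face C) (x ∘ just) → ∂ᵛ (∂ᵛ x) ≋ 𝟎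
    ∂ᵛ∂ᵛ≋0 x x-supp nothing  _ = aug-∂ js (x ∘ just) λ σ ¬within → x-supp σ (λ Cσ → ¬within (within Cσ))
    ∂ᵛ∂ᵛ≋0 x x-supp (just τ) _ = ∂∂≈0 (x ∘ just) τ

    length-js : length js ≡ k
    length-js = length-tabulate _

    column-exact : ∀ {S} q → Face K S → Nonempty S ⊎ (Empty S × q ≡ m) →
      ∀ x → Support (λ cell → At q cell × Carries S cell) x → ∂ᵛ x ≋ 𝟎 →
      ∃[ e ] Support (λ cell → At (suc q) cell × Carries S cell) e × ∂ᵛ e ≋ x
    column-exact {S} ℕ.zero KS bottom x x-supp cycle = e , e-supp , ∂e
      where
      open Filling disjoint (Under S) under-⊆
      -- By `rainbow-size` the only good cell of degree 0 is `nothing`, so filling `x` means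
      -- attaining `x nothing` as an augmentation.
      augmented = augment (face-⊥ C , λ _ _ v∈⊥ → contradiction v∈⊥ ∉⊥) (under-fillable 0 KS bottom)
        js ⊤ (allFin⁺ k) (λ _ → ∈⊤) (λ {i} _ → ∈-allFin i) (x nothing)

      e : Cell → Carrier
      e nothing  = 0#
      e (just σ) = proj₁ augmented σ

      e-supp : Support (λ cell → At 1 cell × Carries S cell) e
      e-supp nothing  _  = refl
      e-supp (just σ) ¬P = proj₁ (proj₂ augmented) σ λ { ((under , _) , size) → ¬P
        (≡.trans (≡.cong suc (≡.trans size (≡.cong (ℕ._+ 0) (∣⊤∣≡n k)))) (≡.sym (+-suc k 0)) , under) }

      ∂e : ∂ᵛ e ≋ x
      ∂e nothing  _       = proj₁ (proj₂ (proj₂ augmented))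
      ∂e (just τ) rainbow = trans (proj₂ (proj₂ (proj₂ augmented)) τ rainbow) (sym (x-supp (just τ) λ { (size , _) →
        1+n≰n (≡.subst₂ _≤_ (≡.trans length-js (≡.sym (≡.trans size (ℕ.+-identityʳ k)))) ≡.refl
          (rainbow-size (allFin⁺ k) rainbow)) }))
    column-exact {S} (suc q) KS bottom x x-supp cycle = e , e-supp , ∂e
      where
      open Filling disjoint (Under S) under-⊆
      filled = fill (suc q) (under-fillable (suc q) KS bottom) js ⊤ (allFin⁺ k) (λ _ → ∈⊤) (x ∘ just)
        (λ σ ¬P → x-supp (just σ) λ { (size , under) → ¬P
          ((under , λ {v} → ⊆⋃⊤ (proj₁ under) {v}) , ≡.trans size (≡.cong (ℕ._+ suc q) (≡.sym (∣⊤∣≡n k)))) })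
        (λ τ → cycle (just τ)) (λ _ → cycle nothing _)

      e : Cell → Carrier
      e nothing  = 0#
      e (just σ) = proj₁ filled σ

      e-size : ∀ σ → ∣ σ ∣ ≡ ∣ ⊤ {k} ∣ ℕ.+ suc q → ∣ σ ∣ ≡ k ℕ.+ suc q
      e-size _ size = ≡.trans size (≡.cong (ℕ._+ suc q) (∣⊤∣≡n k))

      e-supp : Support (λ cell → At (suc (suc q)) cell × Carries S cell) e
      e-supp nothing  _  = refl
      e-supp (just σ) ¬P = proj₁ (proj₂ filled) σ λ { ((under , _) , size) → ¬P
        (≡.trans (≡.cong suc (e-size σ size)) (≡.sym (+-suc k (suc q))) , under) }

      ∂e : ∂ᵛ e ≋ x
      -- `e` lives on simplices with more than `k` vertices, but the augmentation only reads those
      -- with exactly `k`.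
      ∂e nothing  _ = trans
        (aug-vanish-size js _ λ τ size → proj₁ (proj₂ filled) τ λ { (_ , size′) →
          m≢1+m+n k (≡.trans (≡.sym (≡.trans size length-js)) (≡.trans (e-size τ size′) (+-suc k q))) })
        (sym (x-supp nothing λ { (() , _) }))
      ∂e (just τ) rainbow = proj₂ (proj₂ filled) τ rainbow

    -- The double complex of flags and cells.

    Position : ℕ → ℕ → Flag → Cell → Set
    Position p q S cell = Face K S × ∣ S ∣ ≡ p × At q cell × Carries S cell

    Double : ℕ → ℕ → (Flag → Cell → Carrier) → Set ℓ
    Double p q y = ∀ S → Support (Position p q S) (y S)

    ∂ʰ : (Flag → Cell → Carrier) → Flag → Cell → Carrier
    ∂ʰ y S cell = ∂ (λ T → y T cell) S

    ∂ᵛ-∂ʰ : ∀ y S cell → ∂ᵛ (∂ʰ y S) cell ≈ ∂ʰ (∂ᵛ ∘ y) S cell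
    ∂ᵛ-∂ʰ y S cell = homo-∑ (∂ᵛ-linear cell) (λ a → incidence a S) (λ a → y (S ∪ ⁅ a ⁆))

    carries-⊆ : ∀ {S T} cell → S ⊆ T → Carries T cell → Carries S cell
    carries-⊆ nothing  _   _         = _
    carries-⊆ (just τ) S⊆T (Cτ , τ⊆T) = Cτ , λ a a∈S → τ⊆T a (S⊆T a∈S)

    ∂ʰ-double : ∀ {p q y} → Double (suc p) q y → Double p q (∂ʰ y)
    ∂ʰ-double {y = y} y-supp S cell ¬P = ∂-vanish (λ T → y T cell) S λ a a∉S →
      y-supp (S ∪ ⁅ a ⁆) cell λ { (KSa , size , at , carries) → ¬P
        ( face-⊆ K (p⊆p∪q ⁅ a ⁆) KSa
        , suc-injective (≡.trans (≡.sym (∣p∪⁅x⁆∣≡1+∣p∣ a∉S)) size)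
        , at , carries-⊆ cell (p⊆p∪q ⁅ a ⁆) carries ) }

    ∂ᵛ-double : ∀ {p q y} → Double p (suc q) y → Double p q (∂ᵛ ∘ y)
    ∂ᵛ-double {y = y} y-supp S (just τ) ¬P = ∂-vanish (y S ∘ just) τ λ v v∉τ →
      y-supp S (just (τ ∪ ⁅ v ⁆)) λ { (KS , size , at , under) → ¬P
        ( KS , size
        , suc-injective (≡.trans (≡.cong suc (≡.sym (∣p∪⁅x⁆∣≡1+∣p∣ v∉τ))) (≡.trans at (+-suc k _)))
        , under-⊆ {S} (p⊆p∪q ⁅ v ⁆) under ) }
    ∂ᵛ-double {q = ℕ.zero} y-supp S nothing ¬P = homo-0 (aug-linear js) λ σ →
      y-supp S (just σ) λ { (KS , size , _) → ¬P (KS , size , ≡.refl , _) }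
    ∂ᵛ-double {q = suc q} {y} y-supp S nothing ¬P = aug-vanish-size js (y S ∘ just) λ τ size →
      y-supp S (just τ) λ { (_ , _ , at , _) → m≢1+m+n k (suc-injective (≡.trans
        (≡.cong suc (≡.sym (≡.trans size length-js))) (≡.trans at (≡.trans (+-suc k (suc q)) (≡.cong suc (+-suc k q)))))) }

    -- A rainbow `τ` contained in every member of `S` is itself a vertex of `Col`, and adding it to
    -- `S` gives a flag over `τ` again; so `code τ` is a cone apex. Row 0 is excluded: over the
    -- augmentation cell it is the chain complex of `Col` itself.
    row-exact : ∀ {p q} u → Double p (suc q) u → (∀ S → ∂ʰ u S ≋ 𝟎) →
      ∃[ w ] Double (suc p) (suc q) w × (∀ S → ∂ʰ w S ≋ u S)
    row-exact {p} {q} u u-supp cycle = w , w-supp , ∂w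
      where
      rainbow? : Decidable (Rainbow js)
      rainbow? τ = All.all? (λ j → meets? j τ) js

      coned : Flag → Subset N → Carrier
      coned S τ = cone (code τ) (λ T → u T (just τ)) S

      w : Flag → Cell → Carrier
      w S nothing  = 0#
      -- Only a rainbow `τ` yields a vertex of `Col`. The default 0 elsewhere is invisible to `≋`.
      w S (just τ) = restrict rainbow? (coned S) τ

      w-supp : Double (suc p) (suc q) w
      w-supp S nothing  _  = refl
      w-supp S (just τ) ¬P = restrict-vanish rainbow? (coned S) λ rainbow →
        cone-vanish (code τ) (λ T → u T (just τ)) S λ { ρ a∉ρ ≡.refl → u-supp ρ (just τ)
          λ { ((colorful , chain) , size , at , Cτ , τ⊆ρ) → ¬P
            ( insert-face ρ rainbow colorful chain Cτ τ⊆ρ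
            , ≡.trans (∣p∪⁅x⁆∣≡1+∣p∣ a∉ρ) (≡.cong suc size)
            , at , Cτ , insert-above ρ τ⊆ρ ) } }
        where
        a = code τ

        insert : (P : Fin (2 ℕ.^ N) → Set) (ρ : Flag) → (∀ b → b ∈ ρ → P b) → P a → ∀ b → b ∈ ρ ∪ ⁅ a ⁆ → P b
        insert P ρ Pρ Pa b b∈ with x∈p∪q⁻ ρ ⁅ a ⁆ b∈
        ... | inj₁ b∈ρ   = Pρ b b∈ρ
        ... | inj₂ b∈⁅a⁆ = ≡.subst P (≡.sym (x∈⁅y⁆⇒x≡y a b∈⁅a⁆)) Pa

        insert-above : ∀ ρ → (∀ b → b ∈ ρ → τ ⊆ subset N b) → ∀ b → b ∈ ρ ∪ ⁅ a ⁆ → τ ⊆ subset N b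
        insert-above ρ τ⊆ρ = insert (λ b → τ ⊆ subset N b) ρ τ⊆ρ
          (λ {v} → ≡.subst (v ∈_) (≡.sym (subset-code τ)))

        a⊆ : ∀ {b} → τ ⊆ subset N b → subset N a ⊆ subset N b
        a⊆ τ⊆b {v} v∈a = τ⊆b (≡.subst (v ∈_) (subset-code τ) v∈a)

        insert-face : ∀ ρ → Rainbow js τ → (∀ b → b ∈ ρ → Colorful C V (subset N b)) → IsChain C V ρ →
          Face C τ → (∀ b → b ∈ ρ → τ ⊆ subset N b) → Face K (ρ ∪ ⁅ a ⁆)
        insert-face ρ rainbow colorful chain Cτ τ⊆ρ =
          insert (λ b → Colorful C V (subset N b)) ρ colorful
            (≡.subst (Colorful C V) (≡.sym (subset-code τ)) (Cτ , λ i → All.lookup rainbow (∈-allFin i))) ,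
          λ b d b∈ d∈ → insert (λ b → subset N b ⊆ subset N d ⊎ subset N d ⊆ subset N b) ρ
            (λ b b∈ρ → insert (λ d → subset N b ⊆ subset N d ⊎ subset N d ⊆ subset N b) ρ
              (λ d d∈ρ → chain b d b∈ρ d∈ρ) (inj₂ (a⊆ {b} (τ⊆ρ b b∈ρ))) d d∈)
            (inj₁ (a⊆ {d} (insert-above ρ τ⊆ρ d d∈))) b b∈

      ∂w : ∀ S → ∂ʰ w S ≋ u S
      ∂w S nothing  _       = trans (∂-0 S) (sym (u-supp S nothing λ { (_ , _ , () , _) }))
      ∂w S (just τ) rainbow = trans
        (∂-cong (λ T → restrict-yes rainbow? (coned T) rainbow) S)
        (∂-cone-cycle (code τ) (λ T → u T (just τ)) (λ T → cycle T (just τ) rainbow) S)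

    -- Exactness of row `q` at position `p` after passing to the kernel of `∂ᵛ`.
    Exact : ℕ → ℕ → Set (c ⊔ ℓ)
    Exact p q = ∀ y → Double p q y → (∀ S → ∂ʰ y S ≋ 𝟎) → (∀ S → ∂ᵛ (y S) ≋ 𝟎) →
      ∃[ g ] Double (suc p) q g × (∀ S → ∂ʰ g S ≋ y S) × (∀ S → ∂ᵛ (g S) ≋ 𝟎)

    -- Lift y to y′ along ∂ᵛ, correct y′ to a ∂ʰ-cycle y′ - g′ and fill that by w; then g = ∂ᵛ w.

    exact-step : ∀ {p q} → (∀ S → ∣ S ∣ ≡ p → Nonempty S ⊎ (Empty S × q ≡ m)) →
      (∀ y′ → Double p (suc q) y′ → (∀ S → ∂ᵛ (∂ʰ y′ S) ≋ 𝟎) →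
        ∃[ g′ ] Double p (suc q) g′ × (∀ S → ∂ʰ g′ S ≋ ∂ʰ y′ S) × (∀ S → ∂ᵛ (g′ S) ≋ 𝟎)) →
      Exact p q
    exact-step {p} {q} bottom correct y y-supp ∂ʰy ∂ᵛy =
      ∂ᵛ ∘ w , ∂ᵛ-double w-supp , ∂ʰg , λ S → ∂ᵛ∂ᵛ≋0 (w S) λ σ ¬Cσ →
        w-supp S (just σ) λ { (_ , _ , _ , Cσ , _) → ¬Cσ Cσ }
      where
      -- The lift is chosen flag by flag. Where `S` is not a face of size `p`, `y S` vanishes and 0
      -- is a lift.
      column : ∀ S → ∃[ x ] Support (Position p (suc q) S) x × ∂ᵛ x ≋ y S
      column S with face? K S ×-dec (∣ S ∣ ≟ p)
      ... | yes (KS , size) =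
        let x , x-supp , ∂x = column-exact q KS (bottom S size) (y S)
              (λ cell ¬P → y-supp S cell λ { (_ , _ , P) → ¬P P }) (∂ᵛy S)
        in x , (λ cell ¬P → x-supp cell λ P → ¬P (KS , size , P)) , ∂x
      ... | no ¬KS = 𝟎 , (λ _ _ → refl) , λ cell _ → trans (homo-0 (∂ᵛ-linear cell) λ _ → refl)
        (sym (y-supp S cell λ { (KS , size , _) → ¬KS (KS , size) }))

      y′ : Flag → Cell → Carrier
      y′ S = proj₁ (column S)

      y′-supp : Double p (suc q) y′
      y′-supp S = proj₁ (proj₂ (column S))

      ∂ᵛy′ : ∀ S → ∂ᵛ (y′ S) ≋ y S
      ∂ᵛy′ S = proj₂ (proj₂ (column S))

      corrected = correct y′ y′-supp λ S cell good →
        trans (∂ᵛ-∂ʰ y′ S cell) (trans (∂-cong (λ T → ∂ᵛy′ T cell good) S) (∂ʰy S cell good))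
      g′ = proj₁ corrected
      g′-supp = proj₁ (proj₂ corrected)

      u : Flag → Cell → Carrier
      u S cell = y′ S cell + - g′ S cell

      row = row-exact u
        (λ S cell ¬P → trans (x-0≈x (g′-supp S cell ¬P)) (y′-supp S cell ¬P))
        (λ S cell good → trans (homo-sub (∂-linear S) (λ T → y′ T cell) (λ T → g′ T cell))
          (x≈y⇒x∙y⁻¹≈ε (sym (proj₁ (proj₂ (proj₂ corrected)) S cell good))))
      w = proj₁ row
      w-supp = proj₁ (proj₂ row)

      ∂ʰg : ∀ S → ∂ʰ (∂ᵛ ∘ w) S ≋ y S
      ∂ʰg S cell good = begin
        ∂ʰ (∂ᵛ ∘ w) S cell               ≈⟨ ∂ᵛ-∂ʰ w S cell ⟨
        ∂ᵛ (∂ʰ w S) cell                 ≈⟨ ∂ᵛ-cong (proj₂ (proj₂ row) S) cell good ⟩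
        ∂ᵛ (u S) cell                    ≈⟨ homo-sub (∂ᵛ-linear cell) (y′ S) (g′ S) ⟩
        ∂ᵛ (y′ S) cell + - ∂ᵛ (g′ S) cell  ≈⟨ x-0≈x (proj₂ (proj₂ (proj₂ corrected)) S cell good) ⟩
        ∂ᵛ (y′ S) cell                   ≈⟨ ∂ᵛy′ S cell good ⟩
        y S cell                         ∎

    -- Induction on `p` with `p + q` fixed, so the zigzag reaches the empty flag exactly in the
    -- degree `m` of the hypothesis.
    exact : ∀ p q → p ℕ.+ q ≡ m → Exact p q
    exact ℕ.zero  q q≡m   = exact-step
      (λ S size → inj₂ ((λ { (a , a∈S) → 1+n≢0 (≡.trans (x∈p⇒1+∣p-x∣≡∣p∣ a∈S) size) }) , q≡m))
      -- A chain concentrated on the empty flag has zero `∂ʰ`, so the correction is 0.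
      λ y′ y′-supp _ → (λ _ → 𝟎) , (λ _ _ _ → refl) ,
        (λ S cell _ → trans (∂-0 S) (sym (∂-vanish (λ T → y′ T cell) S λ a a∉S →
          y′-supp (S ∪ ⁅ a ⁆) cell λ { (_ , size , _) → 1+n≢0 (≡.trans (≡.sym (∣p∪⁅x⁆∣≡1+∣p∣ a∉S)) size) }))) ,
        (λ _ cell _ → homo-0 (∂ᵛ-linear cell) λ _ → refl)
    exact (suc p) q p+q≡m = exact-step
      (λ S size → inj₁ (nonempty S size))
      -- `∂ʰ y′` is a cycle for both differentials, one position lower and one row higher; its
      -- filling is the correction.
      λ y′ y′-supp ∂ᵛ∂ʰy′ → exact p (suc q) (≡.trans (+-suc p q) p+q≡m) (∂ʰ y′) (∂ʰ-double y′-supp)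
        (λ S cell _ → ∂∂≈0 (λ T → y′ T cell) S) ∂ᵛ∂ʰy′
      where
      nonempty : ∀ S → ∣ S ∣ ≡ suc p → Nonempty S
      nonempty S size with nonempty? S
      ... | yes S-nonempty = S-nonempty
      ... | no S-empty     = contradiction
        (≡.trans (≡.sym size) (≡.trans (≡.cong ∣_∣ (Empty-unique S-empty)) (∣⊥∣≡0 (2 ℕ.^ N)))) 1+n≢0

-- Passage between homology classes and fillings.

open import Data.Nat.Base using (_+_)

theorem4p1 : ∀ {c ℓ} (R : CommutativeRing c ℓ) {N : ℕ} (C : Complex N)
    {n : ℕ} (V : Fin (suc n) → Subset N) → IsPartition C V → (m : ℕ) →
    (∀ (I : Subset (suc n)) → Nonempty I → IsZero (H̃[ R ] ((∣ I ∣ + m) ⊖ 2) (C [ ⋃[ V ] I ]))) →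
    IsZero (H̃[ R ] (m ⊖ 1) (Col C V))
theorem4p1 R {N} C {n} V partition m acyclic z = filling , boundary
  where
  open CommutativeRing R using (_≈_; 0#; refl; sym; trans)
  open Homology R using (Chain; coeff; support; Cycle; chain; closed; Homologous; _,_)
  open ChainCalculus R
  open Colours V using (Fillable)

  fillable : ∀ I → Nonempty I → Fillable (Face C) I m
  fillable I nonempty x x-supp cycle = coeff e , e-supp , λ τ → trans (∂e τ) (x-0≈x refl)
    where
    x-cycle : Cycle (C [ ⋃[ V ] I ]) ((∣ I ∣ + m) ⊖ 2)
    x-cycle = record
      { chain = record
        { coeff   = x
        ; support = λ σ ¬simplex → x-supp σ λ { (face , size) → ¬simplex
            (face , ≡.trans (≡.sym ([1+m]⊖[1+n]≡m⊖n ∣ σ ∣ 1)) (≡.cong (_⊖ 2) size)) }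
        }
      ; closed = cycle
      }
    open Homologous (acyclic I nonempty x-cycle) renaming (filling to e; boundary to ∂e)

    e-supp : Support (λ σ → Face (C [ ⋃[ V ] I ]) σ × ∣ σ ∣ ≡ ∣ I ∣ + m) (coeff e)
    e-supp σ ¬P = support e σ λ { (face , dimension) → ¬P
      (face , ⊖1-injective (≡.trans dimension (suc[m⊖1+n]≡m⊖n (∣ I ∣ + m) 1))) }

  -- The cycle is placed on the augmentation cell, which every flag carries. There `∂ʰ` is the
  -- boundary of `Col`, and simplices of dimension `m - 1` have `p = m` members, so the `nothing`
  -- component of `g` fills `z`.
  y : Subset (2 ℕ.^ N) → Maybe (Subset N) → CommutativeRing.Carrier R
  y S nothing  = coeff (chain z) S
  y S (just _) = 0#

  y-supp : Double C V partition m fillable m 0 y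
  y-supp S nothing  ¬P = support (chain z) S λ { (face , dimension) → ¬P (face , ⊖1-injective dimension , ≡.refl , _) }
  y-supp S (just _) _  = refl

  filled = exact C V partition m fillable m 0 (ℕ.+-identityʳ m) y y-supp
    (λ { S nothing _ → closed z S ; S (just _) _ → ∂-0 S })
    (λ { S nothing _ → homo-0 (Colours.aug-linear V (allFin (suc n))) (λ _ → refl) ; S (just τ) _ → ∂-0 τ })
  g = proj₁ filled

  filling : Chain (Col C V) (ℤ.suc (m ⊖ 1))
  filling = record
    { coeff   = λ S → g S nothing
    ; support = λ S ¬simplex → proj₁ (proj₂ filled) S nothing λ { (face , size , _) → ¬simplex
        (face , ≡.trans (≡.cong (_⊖ 1) size) (≡.trans ([1+m]⊖[1+n]≡m⊖n m 0) (≡.sym (suc[m⊖1+n]≡m⊖n m 0)))) }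
    }

  boundary : ∀ S → ∂ (coeff filling) S ≈ CommutativeRing._-_ R (coeff (chain z) S) 0#
  boundary S = trans (proj₁ (proj₂ (proj₂ filled)) S nothing _) (sym (x-0≈x refl))
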